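{- Let $G$ be a simple connected graph. Then $\gamma(G)\le 2$ (i.e. $G\in\Gamma_{\le 2}$) if and only if $G$ is an induced subgraph of $K_{m,n,o}$ or of $T_n\vee(K_m+K_o)$ for some non-negative integers $m,n,o$.
   Context: For a finite graph $G$ and indeterminates $X_G=\{x_u : u\in V(G)\}$, the generalized Laplacian matrix $L(G,X_G)$ is the $V(G)\times V(G)$ matrix over $\mathbb{Z}[X_G]$ with $(u,u)$-entry $x_u$ and $(u,v)$-entry $-m_{uv}$ for $u\ne v$, $m_{uv}$ being the number of edges between $u$ and $v$. The $i$-th critical ideal $I_i(G,X_G)$ is the ideal of $\mathbb{Z}[X_G]$ generated by all $i\times i$ minors of $L(G,X_G)$ (with $I_i=\langle1\rangle$ for $i<1$, $I_i=\langle 0\rangle$ for $i>|V(G)|$). The algebraic co-rank $\gamma(G)$ is the number of critical ideals of $G$ equal to $\langle 1\rangle$; $\Gamma_{\le 2}$ is the set of simple connected graphs with $\gamma\le 2$. $K_{m,n,o}$ is the complete tripartite graph with parts of sizes $m,n,o$; $T_n$ is the edgeless graph on $n$ vertices; $K_m$ the complete graph on $m$ vertices; $G+H$ is the disjoint union and $G\vee H$ the join (disjoint union plus all edges between $G$ and $H$). -}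

module Defs where

open import Algebra.Bundles.Raw using (RawRing)
import Algebra.Definitions.RawSemiring as RawSemiringDefinitions
open import Data.Bool.Base using (Bool; true; false; not; if_then_else_; T)
open import Data.Fin.Base as Fin using (Fin; toℕ; punchIn)
import Data.Fin.Properties as Fin
open import Data.Fin.Subset as Subset using (Subset; ∣_∣)
open import Data.Integer.Base as ℤ using (ℤ; +_)
open import Data.List.Base as List using (List; []; _∷_; _++_)
open import Data.Nat.Base as ℕ using (ℕ; zero; suc; _≤_)
import Data.Nat.Properties as ℕ
open import Data.Product using (Σ-syntax; ∃-syntax; _×_; _,_)
open import Data.Sum.Base using (_⊎_; inj₁; inj₂)
open import Data.Vec.Base as Vec using (Vec; replicate; zipWith; _[_]≔_)
import Data.Vec.Properties as Vec
open import Function.Bundles using (_⇔_)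
open import Function.Definitions using (Injective)
open import Level using (Level; 0ℓ; _⊔_)
open import Relation.Binary.Construct.Closure.ReflexiveTransitive using (Star)
open import Relation.Binary.Definitions using (Monotonic₁)
open import Relation.Binary.PropositionalEquality
  using (_≡_; refl; sym)
open import Relation.Nullary.Decidable using (does; yes; no)
open import Relation.Nullary.Negation using (contradiction)
open import Relation.Unary using (Pred; ｛_｝; _≐_)

private
  variable
    c ℓ : Level
    V W : Set
    n : ℕ

------------------------------------------------------------------------
-- Simple graphs

record Graph (V : Set) : Set where
  field
    adj    : V → V → Bool
    symm   : ∀ u v → adj u v ≡ adj v u
    irrefl : ∀ v → adj v v ≡ false

open Graph public

Adj : Graph V → V → V → Set
Adj G u v = T (adj G u v)

Connected : Graph V → Set
Connected G = ∀ u v → Star (Adj G) u v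

-- Up to isomorphism: G is the subgraph of H induced on the image of an
-- injection of the vertices.
_IsInducedSubgraphOf_ : Graph V → Graph W → Set
_IsInducedSubgraphOf_ {V} {W} G H =
  Σ[ f ∈ (V → W) ] (Injective _≡_ _≡_ f × (∀ u v → adj G u v ≡ adj H (f u) (f v)))

edgeless : ∀ n → Graph (Fin n)
edgeless n = record
  { adj    = λ _ _ → false
  ; symm   = λ _ _ → refl
  ; irrefl = λ _ → refl
  }

complete : ∀ n → Graph (Fin n)
complete n = record { adj = distinct ; symm = distinct-sym ; irrefl = distinct-irrefl }
  where
  distinct : Fin n → Fin n → Bool
  distinct u v = not (does (u Fin.≟ v))

  distinct-sym : ∀ u v → distinct u v ≡ distinct v u
  distinct-sym u v with u Fin.≟ v | v Fin.≟ u
  ... | yes _   | yes _   = refl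
  ... | no  _   | no  _   = refl
  ... | yes u≡v | no  v≢u = contradiction (sym u≡v) v≢u
  ... | no  u≢v | yes v≡u = contradiction (sym v≡u) u≢v

  distinct-irrefl : ∀ v → distinct v v ≡ false
  distinct-irrefl v with v Fin.≟ v
  ... | yes _   = refl
  ... | no  v≢v = contradiction refl v≢v

-- The vertices of G and H together, with every pair across joined (b = true)
-- or no pair across joined (b = false).
combine : Bool → Graph V → Graph W → Graph (V ⊎ W)
combine {V} {W} b G H = record { adj = adj′ ; symm = symm′ ; irrefl = irrefl′ }
  where
  adj′ : V ⊎ W → V ⊎ W → Bool
  adj′ (inj₁ u) (inj₁ v) = adj G u v
  adj′ (inj₁ _) (inj₂ _) = b
  adj′ (inj₂ _) (inj₁ _) = b
  adj′ (inj₂ u) (inj₂ v) = adj H u v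

  symm′ : ∀ u v → adj′ u v ≡ adj′ v u
  symm′ (inj₁ u) (inj₁ v) = symm G u v
  symm′ (inj₁ _) (inj₂ _) = refl
  symm′ (inj₂ _) (inj₁ _) = refl
  symm′ (inj₂ u) (inj₂ v) = symm H u v

  irrefl′ : ∀ v → adj′ v v ≡ false
  irrefl′ (inj₁ v) = irrefl G v
  irrefl′ (inj₂ v) = irrefl H v

infixr 6 _∔_
infixr 5 _∨_

-- Disjoint union
_∔_ : Graph V → Graph W → Graph (V ⊎ W)
_∔_ = combine false

-- Join
_∨_ : Graph V → Graph W → Graph (V ⊎ W)
_∨_ = combine true

completeTripartite : ∀ m n o → Graph (Fin m ⊎ Fin n ⊎ Fin o)
completeTripartite m n o = edgeless m ∨ edgeless n ∨ edgeless o

------------------------------------------------------------------------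
-- Determinants, minors and ideals

module _ (R : RawRing c ℓ) where
  open RawRing R
  open RawSemiringDefinitions rawSemiring using (sum; _^_)

  Matrix : ℕ → ℕ → Set c
  Matrix m n = Fin m → Fin n → Carrier

  -- Expansion along the first row.
  det : ∀ n → Matrix n n → Carrier
  det zero    M = 1#
  det (suc n) M = sum λ j →
    (- 1#) ^ toℕ j * (M Fin.zero j * det n (λ a b → M (Fin.suc a) (punchIn j b)))

  -- The k-subsets of the rows and of the columns are listed in increasing
  -- order.  There is exactly one 0×0 minor, namely 1, and there are no k×k
  -- minors once k exceeds the size of M.
  Minor : ∀ {m n} → Matrix m n → ℕ → Pred Carrier c
  Minor {m} {n} M k p =
    Σ[ r ∈ (Fin k → Fin m) ] Σ[ s ∈ (Fin k → Fin n) ]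
      (Monotonic₁ Fin._<_ Fin._<_ r × Monotonic₁ Fin._<_ Fin._<_ s ×
       p ≡ det k (λ a b → M (r a) (s b)))

  data Ideal⟨_⟩ {a} (S : Pred Carrier a) : Pred Carrier (a ⊔ c ⊔ ℓ) where
    gen   : ∀ {p} → S p → Ideal⟨ S ⟩ p
    zer   : Ideal⟨ S ⟩ 0#
    add   : ∀ {p q} → Ideal⟨ S ⟩ p → Ideal⟨ S ⟩ q → Ideal⟨ S ⟩ (p + q)
    mul   : ∀ p {q} → Ideal⟨ S ⟩ q → Ideal⟨ S ⟩ (p * q)
    resp  : ∀ {p q} → p ≈ q → Ideal⟨ S ⟩ p → Ideal⟨ S ⟩ q

------------------------------------------------------------------------
-- The polynomial ring ℤ[x₀,…,xₙ₋₁]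

-- The vector of exponents.
Monomial : ℕ → Set
Monomial n = Vec ℕ n

-- A formal sum of terms, in which a monomial may occur several times or with
-- coefficient 0; two of them are equal as polynomials if all their collected
-- coefficients agree.
Poly : ℕ → Set
Poly n = List (ℤ × Monomial n)

coeff : Poly n → Monomial n → ℤ
coeff []            m = ℤ.0ℤ
coeff ((c , a) ∷ p) m =
  (if does (Vec.≡-dec ℕ._≟_ a m) then c else ℤ.0ℤ) ℤ.+ coeff p m

_≈ₚ_ : Poly n → Poly n → Set
p ≈ₚ q = ∀ m → coeff p m ≡ coeff q m

_*ₜ_ : ℤ × Monomial n → ℤ × Monomial n → ℤ × Monomial n
(c , a) *ₜ (d , b) = c ℤ.* d , zipWith ℕ._+_ a b

_*ₚ_ : Poly n → Poly n → Poly n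
_*ₚ_ = List.cartesianProductWith _*ₜ_

-ₚ_ : Poly n → Poly n
-ₚ_ = List.map λ (c , a) → ℤ.- c , a

const : ℤ → Poly n
const c = (c , replicate _ 0) ∷ []

var : Fin n → Poly n
var i = (ℤ.1ℤ , replicate _ 0 [ i ]≔ 1) ∷ []

ℤ[X] : ℕ → RawRing 0ℓ 0ℓ
ℤ[X] n = record
  { Carrier = Poly n
  ; _≈_     = _≈ₚ_
  ; _+_     = _++_
  ; _*_     = _*ₚ_
  ; -_      = -ₚ_
  ; 0#      = []
  ; 1#      = const ℤ.1ℤ
  }

------------------------------------------------------------------------
-- Critical ideals

multiplicity : Graph V → V → V → ℕ
multiplicity G u v = if adj G u v then 1 else 0

laplacian : Graph (Fin n) → Matrix (ℤ[X] n) n n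
laplacian G u v =
  if does (u Fin.≟ v) then var u else const (ℤ.- (+ multiplicity G u v))

criticalIdeal : Graph (Fin n) → ℕ → Pred (Poly n) 0ℓ
criticalIdeal {n} G i = Ideal⟨_⟩ (ℤ[X] n) (Minor (ℤ[X] n) (laplacian G) i)

unitIdeal : Pred (Poly n) 0ℓ
unitIdeal {n} = Ideal⟨_⟩ (ℤ[X] n) ｛ const ℤ.1ℤ ｝

-- The count runs over I₁,…,Iₙ: the ideals Iᵢ with i < 1 are ⟨1⟩ by convention
-- and are not counted, and those with i > n are ⟨0⟩.  The co-rank is a
-- relation, because a function computing it would have to decide whether an
-- ideal of ℤ[X] is ⟨1⟩.
AlgebraicCorank : Graph (Fin n) → ℕ → Set
AlgebraicCorank {n} G γ =
  Σ[ S ∈ Subset n ]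
    ((∀ i → i Subset.∈ S ⇔ criticalIdeal G (suc (toℕ i)) ≐ unitIdeal) × ∣ S ∣ ≡ γ)

AlgebraicCorank≤ : Graph (Fin n) → ℕ → Set
AlgebraicCorank≤ G k = ∃[ γ ] (AlgebraicCorank G γ × γ ≤ k)

{-# OPTIONS --safe #-}

-- A vertex set coloured so that the adjacency of two vertices depends only on
-- their colours gives, at xᵥ = -[colour of v is a clique], an integer matrix
-- with repeated rows and columns.  For the two patterns on three colours in the
-- theorem its 3×3 minors are even, so I₃ ≠ ⟨1⟩.  Whether I₁ and I₂ are ⟨1⟩ is
-- decided by the existence of an edge and of an induced path on three vertices.
--
-- Conversely, each of P₄, the cricket, the dart, K₅ minus two adjacent edges and
-- K₆ minus two disjoint edges has a 3×3 minor equal to -1, so γ(G) ≤ 2 excludes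
-- them.  If some vertex v is adjacent to neither end of an edge uw, excluding them
-- makes adjacency to u and to v determine the part of Tₙ ∨ (Kₘ + Kₒ) to which a
-- vertex belongs.  Otherwise non-adjacency is transitive, and two parts with at
-- least two vertices each leave no room for an edge outside them.
module Submission where

open import Defs
open import Algebra.Bundles using (CommutativeRing)
open import Algebra.Bundles.Raw using (RawRing)
import Algebra.Definitions.RawSemiring as RawSemiringDefinitions
open import Algebra.Morphism.Structures using (module RingMorphisms)
import Algebra.Properties.CommutativeSemigroup as CommutativeSemigroupProperties
import Algebra.Properties.Ring as RingProperties
import Algebra.Solver.Ring as RingSolver
open import Algebra.Solver.Ring.AlmostCommutativeRing
  using (fromCommutativeRing; _-Raw-AlmostCommutative⟶_)
open import Data.Bool.Base using (Bool; true; false; not; if_then_else_)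
import Data.Bool.Properties as Bool
open import Data.Empty using (⊥-elim)
open import Data.Fin.Base as Fin using (Fin; zero; suc; toℕ; punchIn; remQuot)
open import Data.Fin.Patterns using (0F; 1F; 2F)
import Data.Fin.Properties as Fin
open import Data.Fin.Subset as Subset using (Subset; ∣_∣; inside; outside)
open import Data.Integer.Base as ℤ using (ℤ; 0ℤ; 1ℤ; +_; _+_; _*_)
open import Data.Integer.Divisibility.Signed as ℤ using (_∣_; _∣?_)
import Data.Integer.Properties as ℤ
open import Data.Integer.Tactic.RingSolver using (solve-∀)
open import Data.List.Base as List using (List; []; _∷_; _++_; length; filter)
import Data.List.Properties as List
open import Data.Maybe.Base using (just; nothing)
open import Data.Nat.Base as ℕ using (ℕ; zero; suc; z≤n; s≤s)
import Data.Nat.Properties as ℕ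
open import Data.Product using (∃-syntax; _×_; _,_; proj₁; proj₂; uncurry)
open import Data.Sum.Base using (_⊎_; inj₁; inj₂)
open import Data.Vec.Base as Vec
  using (Vec; []; _∷_; here; there; zipWith; replicate; tabulate; lookup; _[_]≔_)
import Data.Vec.Properties as Vec
open import Function.Base using (_∘_; id)
open import Function.Bundles using (_⇔_; mk⇔; Equivalence)
open import Function.Definitions using (Injective)
open import Level using (0ℓ)
open import Relation.Binary.Construct.Closure.ReflexiveTransitive using (Star; ε; _◅_)
open import Relation.Binary.Definitions using (Monotonic₁; tri<; tri≈; tri>)
open import Relation.Binary.PropositionalEquality
  using (_≡_; _≢_; refl; sym; ≢-sym; trans; cong; cong₂; subst; module ≡-Reasoning)
open import Relation.Binary.Structures using (IsEquivalence)
open import Relation.Nullary.Decidable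
  using (Dec; does; yes; no; ¬?; _×-dec_; from-yes; from-no; dec-false)
open import Relation.Nullary.Negation using (¬_; contradiction)
open import Relation.Unary using (Pred; _⊆_; _≐_)

private
  variable
    n : ℕ
    V W : Set

-- Determinants

module _ {c ℓ r ρ} (R : RawRing r ρ) (S : CommutativeRing c ℓ) where
  private
    module R = RawRing R
    module S = CommutativeRing S
    module ΣR = RawSemiringDefinitions R.rawSemiring
    module ΣS = RawSemiringDefinitions (RawRing.rawSemiring S.rawRing)
  open S using (_≈_)
  open RingMorphisms R S.rawRing using (IsRingHomomorphism)

  sum-homo : ∀ {⟦_⟧} → IsRingHomomorphism ⟦_⟧ →
    ∀ {n} {f : Fin n → R.Carrier} {g : Fin n → S.Carrier} →
    (∀ i → ⟦ f i ⟧ ≈ g i) → ⟦ ΣR.sum f ⟧ ≈ ΣS.sum g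
  sum-homo isHom {zero}  f≈g = IsRingHomomorphism.0#-homo isHom
  sum-homo isHom {suc n} f≈g = S.trans (+-homo _ _)
    (S.+-cong (f≈g zero) (sum-homo isHom (λ i → f≈g (suc i))))
    where open IsRingHomomorphism isHom

  sign-homo : ∀ {⟦_⟧} → IsRingHomomorphism ⟦_⟧ →
    ∀ k → ⟦ (R.- R.1#) ΣR.^ k ⟧ ≈ (S.- S.1#) ΣS.^ k
  sign-homo isHom zero    = IsRingHomomorphism.1#-homo isHom
  sign-homo isHom (suc k) = S.trans (*-homo _ _)
    (S.*-cong (S.trans (-‿homo _) (S.-‿cong 1#-homo)) (sign-homo isHom k))
    where open IsRingHomomorphism isHom

  -- The source is only a raw ring, so this covers both the syntactic terms of the ring solver,
  -- which satisfy no ring laws, and the evaluations of polynomials at integers.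
  det-homo : ∀ {⟦_⟧} → IsRingHomomorphism ⟦_⟧ →
    ∀ n {M : Fin n → Fin n → R.Carrier} {M′ : Fin n → Fin n → S.Carrier} →
    (∀ i j → ⟦ M i j ⟧ ≈ M′ i j) → ⟦ det R n M ⟧ ≈ det S.rawRing n M′
  det-homo isHom zero    M≈M′ = IsRingHomomorphism.1#-homo isHom
  det-homo isHom (suc n) M≈M′ = sum-homo isHom λ j →
    S.trans (*-homo _ _) (S.*-cong (sign-homo isHom (toℕ j))
      (S.trans (*-homo _ _) (S.*-cong (M≈M′ zero j)
        (det-homo isHom n λ a b → M≈M′ (suc a) (punchIn j b)))))
    where open IsRingHomomorphism isHom

transpose₀₁ : ∀ {n} → Fin (2 ℕ.+ n) → Fin (2 ℕ.+ n)
transpose₀₁ zero          = suc zero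
transpose₀₁ (suc zero)    = zero
transpose₀₁ (suc (suc i)) = suc (suc i)

transpose₁₂ : Fin 3 → Fin 3
transpose₁₂ zero    = zero
transpose₁₂ (suc i) = suc (transpose₀₁ i)

module Determinants {c ℓ} (R : CommutativeRing c ℓ)
  (morphism : ℤ.+-*-rawRing -Raw-AlmostCommutative⟶ fromCommutativeRing R) where

  open CommutativeRing R using (Carrier; _≈_; rawRing; reflexive; -‿cong)
    renaming (-_ to ⊖_; refl to ≈-refl; sym to ≈-sym; trans to ≈-trans)
  open _-Raw-AlmostCommutative⟶_ morphism using () renaming (⟦_⟧ to ι)

  private
    coeff≟ : (c d : ℤ) → _
    coeff≟ c d with c ℤ.≟ d
    ... | yes c≡d = just (reflexive (cong ι c≡d))
    ... | no  _   = nothing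

  open RingSolver ℤ.+-*-rawRing (fromCommutativeRing R) morphism coeff≟
    renaming (var to indeterminate)

  -- Solver terms under syntactic equality: running `det` here produces the solver's expression for
  -- a determinant.
  Polynomial-rawRing : ℕ → RawRing 0ℓ 0ℓ
  Polynomial-rawRing m = record
    { Carrier = Polynomial m
    ; _≈_ = _≡_ ; _+_ = _:+_ ; _*_ = _:*_ ; -_ = :-_ ; 0# = con 0ℤ ; 1# = con 1ℤ }

  ⟦⟧-isRingHomomorphism : ∀ {m} (ρ : Vec Carrier m) →
    RingMorphisms.IsRingHomomorphism (Polynomial-rawRing m) rawRing (λ p → ⟦ p ⟧ ρ)
  ⟦⟧-isRingHomomorphism ρ = record
    { isSemiringHomomorphism = record
      { isNearSemiringHomomorphism = record
        { +-isMonoidHomomorphism = record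
          { isMagmaHomomorphism = record
            { isRelHomomorphism = record { cong = λ { refl → ≈-refl } }
            ; homo = λ _ _ → ≈-refl
            }
          ; ε-homo = _-Raw-AlmostCommutative⟶_.0-homo morphism
          }
        ; *-homo = λ _ _ → ≈-refl
        }
      ; 1#-homo = _-Raw-AlmostCommutative⟶_.1-homo morphism
      }
    ; -‿homo = λ _ → ≈-refl
    }

  ⟦det⟧ : ∀ {m} (ρ : Vec Carrier m) k (X : Fin k → Fin k → Polynomial m) {M} →
    (∀ a b → ⟦ X a b ⟧ ρ ≈ M a b) → ⟦ det (Polynomial-rawRing m) k X ⟧ ρ ≈ det rawRing k M
  ⟦det⟧ ρ k X = det-homo _ R (⟦⟧-isRingHomomorphism ρ) k

  generic : ∀ k → Fin k → Fin k → Polynomial (k ℕ.* k)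
  generic k a b = indeterminate (Fin.combine a b)

  -- It suffices to compare normal forms for the generic matrix, whose entries are distinct
  -- indeterminates; substituting the entries of `M` gives the general case. For a fixed small `k`
  -- the hypothesis holds by computation.
  det-permute : ∀ k (σ τ : Fin k → Fin k) →
    (∀ ρ → ⟦ det (Polynomial-rawRing _) k (λ a b → generic k (σ a) (τ b)) ⟧↓ ρ ≈
           ⟦ :- det (Polynomial-rawRing _) k (generic k) ⟧↓ ρ) →
    ∀ M → det rawRing k (λ a b → M (σ a) (τ b)) ≈ ⊖ det rawRing k M
  det-permute k σ τ eq M =
    ≈-trans (≈-sym (⟦det⟧ env k permuted λ a b → entry (σ a) (τ b)))
    (≈-trans (prove env (det (Polynomial-rawRing _) k permuted) (:- det (Polynomial-rawRing _) k (generic k)) (eq env))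
    (-‿cong (⟦det⟧ env k (generic k) entry)))
    where
    permuted : Fin k → Fin k → Polynomial (k ℕ.* k)
    permuted a b = generic k (σ a) (τ b)

    env : Vec Carrier (k ℕ.* k)
    env = tabulate (uncurry M ∘ remQuot k)

    entry : ∀ a b → lookup env (Fin.combine a b) ≈ M a b
    entry a b = reflexive (trans (Vec.lookup∘tabulate _ (Fin.combine a b))
      (cong (uncurry M) (Fin.remQuot-combine a b)))

  -- `X` is a template for `M`: prescribed entries are constants, unknown ones are indeterminates,
  -- so that the solver can see which unknowns cancel.
  det-evaluate : ∀ k {m} (X : Fin k → Fin k → Polynomial m) (ρ : Vec Carrier m) p →
    (∀ ρ → ⟦ det (Polynomial-rawRing _) k X ⟧↓ ρ ≈ ⟦ p ⟧↓ ρ) →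
    ∀ M → (∀ a b → ⟦ X a b ⟧ ρ ≈ M a b) → det rawRing k M ≈ ⟦ p ⟧ ρ
  det-evaluate k X ρ p eq M X≈M =
    ≈-trans (≈-sym (⟦det⟧ ρ k X X≈M)) (prove ρ (det (Polynomial-rawRing _) k X) p (eq ρ))

  det₂-rows₀₁ : ∀ M → det rawRing 2 (λ a b → M (transpose₀₁ a) b) ≈ ⊖ det rawRing 2 M
  det₂-rows₀₁ = det-permute 2 transpose₀₁ id λ _ → ≈-refl

  det₂-columns₀₁ : ∀ M → det rawRing 2 (λ a b → M a (transpose₀₁ b)) ≈ ⊖ det rawRing 2 M
  det₂-columns₀₁ = det-permute 2 id transpose₀₁ λ _ → ≈-refl

  det₃-rows₀₁ : ∀ M → det rawRing 3 (λ a b → M (transpose₀₁ a) b) ≈ ⊖ det rawRing 3 M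
  det₃-rows₀₁ = det-permute 3 transpose₀₁ id λ _ → ≈-refl

  det₃-columns₀₁ : ∀ M → det rawRing 3 (λ a b → M a (transpose₀₁ b)) ≈ ⊖ det rawRing 3 M
  det₃-columns₀₁ = det-permute 3 id transpose₀₁ λ _ → ≈-refl

  det₃-rows₁₂ : ∀ M → det rawRing 3 (λ a b → M (transpose₁₂ a) b) ≈ ⊖ det rawRing 3 M
  det₃-rows₁₂ = det-permute 3 transpose₁₂ id λ _ → ≈-refl

  det₃-columns₁₂ : ∀ M → det rawRing 3 (λ a b → M a (transpose₁₂ b)) ≈ ⊖ det rawRing 3 M
  det₃-columns₁₂ = det-permute 3 id transpose₁₂ λ _ → ≈-refl

  det₁-entry : ∀ M → M 0F 0F ≈ ι ℤ.-1ℤ → det rawRing 1 M ≈ ι ℤ.-1ℤ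
  det₁-entry M m₀₀ = det-evaluate 1 {0} (λ _ _ → con ℤ.-1ℤ) [] (con ℤ.-1ℤ) (λ _ → ≈-refl) M λ where
    0F 0F → ≈-sym m₀₀

  det₂-triangular : ∀ M → M 0F 0F ≈ ι ℤ.-1ℤ → M 0F 1F ≈ ι 0ℤ → M 1F 1F ≈ ι ℤ.-1ℤ →
    det rawRing 2 M ≈ ι 1ℤ
  det₂-triangular M m₀₀ m₀₁ m₁₁ =
    det-evaluate 2 X (M 1F 0F ∷ []) (con 1ℤ) (λ _ → ≈-refl) M λ where
      0F 0F → ≈-sym m₀₀ ; 0F 1F → ≈-sym m₀₁
      1F 0F → ≈-refl    ; 1F 1F → ≈-sym m₁₁
    where
    X : Fin 2 → Fin 2 → Polynomial 1
    X 0F 0F = con ℤ.-1ℤ        ; X 0F 1F = con 0ℤ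
    X 1F 0F = indeterminate 0F ; X 1F 1F = con ℤ.-1ℤ

  det₃-triangular : ∀ M →
    M 0F 0F ≈ ι ℤ.-1ℤ → M 1F 1F ≈ ι ℤ.-1ℤ → M 2F 2F ≈ ι ℤ.-1ℤ →
    M 0F 1F ≈ ι 0ℤ → M 0F 2F ≈ ι 0ℤ → M 1F 2F ≈ ι 0ℤ →
    det rawRing 3 M ≈ ι ℤ.-1ℤ
  det₃-triangular M m₀₀ m₁₁ m₂₂ m₀₁ m₀₂ m₁₂ =
    det-evaluate 3 X (M 1F 0F ∷ M 2F 0F ∷ M 2F 1F ∷ []) (con ℤ.-1ℤ) (λ _ → ≈-refl) M λ where
      0F 0F → ≈-sym m₀₀ ; 0F 1F → ≈-sym m₀₁ ; 0F 2F → ≈-sym m₀₂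
      1F 0F → ≈-refl    ; 1F 1F → ≈-sym m₁₁ ; 1F 2F → ≈-sym m₁₂
      2F 0F → ≈-refl    ; 2F 1F → ≈-refl    ; 2F 2F → ≈-sym m₂₂
    where
    X : Fin 3 → Fin 3 → Polynomial 3
    X 0F 0F = con ℤ.-1ℤ        ; X 0F 1F = con 0ℤ           ; X 0F 2F = con 0ℤ
    X 1F 0F = indeterminate 0F ; X 1F 1F = con ℤ.-1ℤ        ; X 1F 2F = con 0ℤ
    X 2F 0F = indeterminate 1F ; X 2F 1F = indeterminate 2F ; X 2F 2F = con ℤ.-1ℤ

  -- The entry in row 1 and column 0 cancels: up to sign, its cofactor is the determinant of a 2×2
  -- matrix with all entries -1.
  det₃-near-triangular : ∀ M →
    M 0F 0F ≈ ι 0ℤ → M 1F 1F ≈ ι 0ℤ →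
    M 0F 1F ≈ ι ℤ.-1ℤ → M 0F 2F ≈ ι ℤ.-1ℤ → M 1F 2F ≈ ι ℤ.-1ℤ →
    M 2F 0F ≈ ι ℤ.-1ℤ → M 2F 1F ≈ ι ℤ.-1ℤ → M 2F 2F ≈ ι ℤ.-1ℤ →
    det rawRing 3 M ≈ ι ℤ.-1ℤ
  det₃-near-triangular M m₀₀ m₁₁ m₀₁ m₀₂ m₁₂ m₂₀ m₂₁ m₂₂ =
    det-evaluate 3 X (M 1F 0F ∷ []) (con ℤ.-1ℤ) (λ _ → ≈-refl) M λ where
      0F 0F → ≈-sym m₀₀ ; 0F 1F → ≈-sym m₀₁ ; 0F 2F → ≈-sym m₀₂
      1F 0F → ≈-refl    ; 1F 1F → ≈-sym m₁₁ ; 1F 2F → ≈-sym m₁₂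
      2F 0F → ≈-sym m₂₀ ; 2F 1F → ≈-sym m₂₁ ; 2F 2F → ≈-sym m₂₂
    where
    X : Fin 3 → Fin 3 → Polynomial 1
    X 0F 0F = con 0ℤ           ; X 0F 1F = con ℤ.-1ℤ ; X 0F 2F = con ℤ.-1ℤ
    X 1F 0F = indeterminate 0F ; X 1F 1F = con 0ℤ    ; X 1F 2F = con ℤ.-1ℤ
    X 2F 0F = con ℤ.-1ℤ        ; X 2F 1F = con ℤ.-1ℤ ; X 2F 2F = con ℤ.-1ℤ

-- The ring ℤ[X]

-- A polynomial is equal to another one exactly if it has the same pairing with
-- every function on the monomials.  The coefficients, the evaluations at
-- integers and, iterated, the products are all such pairings.
pair : (Monomial n → ℤ) → Poly n → ℤ
pair g []            = 0ℤ
pair g ((c , a) ∷ p) = c * g a + pair g p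

δ : Monomial n → Monomial n → ℤ
δ m a = if does (Vec.≡-dec ℕ._≟_ a m) then 1ℤ else 0ℤ

coeff≡pair : ∀ (p : Poly n) m → coeff p m ≡ pair (δ m) p
coeff≡pair []            m = refl
coeff≡pair ((c , a) ∷ p) m = cong₂ _+_ (head (does (Vec.≡-dec ℕ._≟_ a m))) (coeff≡pair p m)
  where
  head : ∀ b → (if b then c else 0ℤ) ≡ c * (if b then 1ℤ else 0ℤ)
  head true  = sym (ℤ.*-identityʳ c)
  head false = sym (ℤ.*-zeroʳ c)

pair-cong : ∀ {f g : Monomial n → ℤ} → (∀ a → f a ≡ g a) → ∀ p → pair f p ≡ pair g p
pair-cong f≗g []            = refl
pair-cong f≗g ((c , a) ∷ p) = cong₂ _+_ (cong (c *_) (f≗g a)) (pair-cong f≗g p)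

pair-++ : ∀ (g : Monomial n → ℤ) p q → pair g (p ++ q) ≡ pair g p + pair g q
pair-++ g []            q = sym (ℤ.+-identityˡ _)
pair-++ g ((c , a) ∷ p) q =
  trans (cong (_+_ (c * g a)) (pair-++ g p q)) (sym (ℤ.+-assoc (c * g a) _ _))

pair-neg : ∀ (g : Monomial n → ℤ) p → pair g (-ₚ p) ≡ ℤ.- pair g p
pair-neg g []            = refl
pair-neg g ((c , a) ∷ p) = trans (cong (_+_ (ℤ.- c * g a)) (pair-neg g p)) (lemma c (g a) _)
  where
  lemma : ∀ c x y → ℤ.- c * x + ℤ.- y ≡ ℤ.- (c * x + y)
  lemma = solve-∀

pair-0 : ∀ (p : Poly n) → pair (λ _ → 0ℤ) p ≡ 0ℤ
pair-0 []            = refl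
pair-0 ((c , a) ∷ p) = cong₂ _+_ (ℤ.*-zeroʳ c) (pair-0 p)

pair-linear : ∀ d (f g : Monomial n → ℤ) p →
  pair (λ a → d * f a + g a) p ≡ d * pair f p + pair g p
pair-linear d f g []            = sym (trans (ℤ.+-identityʳ _) (ℤ.*-zeroʳ d))
pair-linear d f g ((c , a) ∷ p) =
  trans (cong (_+_ (c * (d * f a + g a))) (pair-linear d f g p)) (lemma c d (f a) (g a) _ _)
  where
  lemma : ∀ c d x y u v →
    c * (d * x + y) + (d * u + v) ≡ d * (c * x + u) + (c * y + v)
  lemma = solve-∀

pair-scale : ∀ d (f : Monomial n → ℤ) p → pair (λ a → d * f a) p ≡ d * pair f p
pair-scale d f p = trans (pair-cong (λ a → sym (ℤ.+-identityʳ _)) p)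
  (trans (pair-linear d f (λ _ → 0ℤ) p)
  (trans (cong (_+_ (d * pair f p)) (pair-0 p)) (ℤ.+-identityʳ _)))

-- Interchange of two finite sums; this is what makes multiplication commutative.
pair-swap : ∀ (h : Monomial n → Monomial n → ℤ) p q →
  pair (λ a → pair (h a) q) p ≡ pair (λ b → pair (λ a → h a b) p) q
pair-swap h []            q = sym (pair-0 q)
pair-swap h ((c , a) ∷ p) q =
  trans (cong (_+_ (c * pair (h a) q)) (pair-swap h p q)) (sym (pair-linear c (h a) _ q))

pair-*ₜ : ∀ (g : Monomial n → ℤ) c a q →
  pair g (List.map ((c , a) *ₜ_) q) ≡ c * pair (λ b → g (zipWith ℕ._+_ a b)) q
pair-*ₜ g c a []            = sym (ℤ.*-zeroʳ c)
pair-*ₜ g c a ((d , b) ∷ q) =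
  trans (cong (_+_ (c * d * _)) (pair-*ₜ g c a q)) (lemma c d _ _)
  where
  lemma : ∀ c d x y → c * d * x + c * y ≡ c * (d * x + y)
  lemma = solve-∀

pair-* : ∀ (g : Monomial n → ℤ) p q →
  pair g (p *ₚ q) ≡ pair (λ a → pair (λ b → g (zipWith ℕ._+_ a b)) q) p
pair-* g []            q = refl
pair-* g ((c , a) ∷ p) q = trans (pair-++ g (List.map ((c , a) *ₜ_) q) (p *ₚ q))
  (cong₂ _+_ (pair-*ₜ g c a q) (pair-* g p q))

remove : Monomial n → Poly n → Poly n
remove m = filter λ (_ , a) → ¬? (Vec.≡-dec ℕ._≟_ a m)

pair-remove : ∀ (g : Monomial n → ℤ) m p →
  pair g p ≡ coeff p m * g m + pair g (remove m p)
pair-remove g m []            = refl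
pair-remove g m ((c , a) ∷ p) with Vec.≡-dec ℕ._≟_ a m
... | yes refl = trans (cong (_+_ (c * g m)) (pair-remove g m p)) (lemma c (g m) (coeff p m) _)
  where
  lemma : ∀ c x d y → c * x + (d * x + y) ≡ (c + d) * x + y
  lemma = solve-∀
... | no  _    = trans (cong (_+_ (c * g a)) (pair-remove g m p)) (lemma (c * g a) (coeff p m) (g m) _)
  where
  lemma : ∀ x d y z → x + (d * y + z) ≡ (0ℤ + d) * y + (x + z)
  lemma = solve-∀

-- All terms with the leading monomial are removed together: they contribute a multiple of their
-- collected coefficient, which is 0. What remains is not a structural part of the list, hence the
-- induction on a bound `k` for the length.
≈0⇒pair≡0 : ∀ (g : Monomial n → ℤ) k p → length p ℕ.≤ k → p ≈ₚ [] → pair g p ≡ 0ℤ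
≈0⇒pair≡0 g k       []            _          _   = refl
≈0⇒pair≡0 g (suc k) P@((c , a) ∷ p) (ℕ.s≤s |p|≤k) P≈0 = begin
  pair g P                                 ≡⟨ pair-remove g a P ⟩
  coeff P a * g a + pair g (remove a P)    ≡⟨ cong (λ x → x * g a + pair g (remove a P)) (P≈0 a) ⟩
  0ℤ * g a + pair g (remove a P)           ≡⟨ ℤ.+-identityˡ _ ⟩
  pair g (remove a P)                      ≡⟨ ≈0⇒pair≡0 g k (remove a P) shorter removed≈0 ⟩
  0ℤ                                       ∎
  where
  open ≡-Reasoning

  -- The head of `P` carries the monomial `a` itself, so at least one term disappears.
  shorter : length (remove a P) ℕ.≤ k
  shorter with Vec.≡-dec ℕ._≟_ a a
  ... | yes _   = ℕ.≤-trans (List.length-filter (λ (_ , b) → ¬? (Vec.≡-dec ℕ._≟_ b a)) p) |p|≤k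
  ... | no  a≢a = contradiction refl a≢a

  removed≈0 : remove a P ≈ₚ []
  removed≈0 m = begin
    coeff (remove a P) m                             ≡⟨ coeff≡pair (remove a P) m ⟩
    pair (δ m) (remove a P)                          ≡⟨ ℤ.+-identityˡ _ ⟨
    0ℤ * δ m a + pair (δ m) (remove a P)             ≡⟨ cong (λ x → x * δ m a + pair (δ m) (remove a P)) (P≈0 a) ⟨
    coeff P a * δ m a + pair (δ m) (remove a P)      ≡⟨ pair-remove (δ m) a P ⟨
    pair (δ m) P                                     ≡⟨ coeff≡pair P m ⟨
    coeff P m                                        ≡⟨ P≈0 m ⟩
    0ℤ                                               ∎

≈⇒pair≡ : ∀ (p q : Poly n) → p ≈ₚ q → ∀ g → pair g p ≡ pair g q
≈⇒pair≡ p q p≈q g = ℤ.i-j≡0⇒i≡j _ _ (begin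
  pair g p + ℤ.- pair g q    ≡⟨ cong (_+_ (pair g p)) (pair-neg g q) ⟨
  pair g p + pair g (-ₚ q) ≡⟨ pair-++ g p (-ₚ q) ⟨
  pair g (p ++ -ₚ q)       ≡⟨ ≈0⇒pair≡0 g _ (p ++ -ₚ q) ℕ.≤-refl difference≈0 ⟩
  0ℤ                       ∎)
  where
  open ≡-Reasoning

  difference≈0 : (p ++ -ₚ q) ≈ₚ []
  difference≈0 m = begin
    coeff (p ++ -ₚ q) m               ≡⟨ coeff≡pair (p ++ -ₚ q) m ⟩
    pair (δ m) (p ++ -ₚ q)            ≡⟨ pair-++ (δ m) p (-ₚ q) ⟩
    pair (δ m) p + pair (δ m) (-ₚ q)  ≡⟨ cong (_+_ (pair (δ m) p)) (pair-neg (δ m) q) ⟩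
    pair (δ m) p + ℤ.- pair (δ m) q     ≡⟨ cong₂ (λ x y → x + ℤ.- y) (coeff≡pair p m) (coeff≡pair q m) ⟨
    coeff p m + ℤ.- coeff q m           ≡⟨ cong (λ x → x + ℤ.- coeff q m) (p≈q m) ⟩
    coeff q m + ℤ.- coeff q m           ≡⟨ ℤ.+-inverseʳ (coeff q m) ⟩
    0ℤ                                ∎

pair≡⇒≈ : ∀ (p q : Poly n) → (∀ g → pair g p ≡ pair g q) → p ≈ₚ q
pair≡⇒≈ p q eq m =
  trans (coeff≡pair p m) (trans (eq (δ m)) (sym (coeff≡pair q m)))

*ₚ-comm : ∀ (p q : Poly n) → (p *ₚ q) ≈ₚ (q *ₚ p)
*ₚ-comm p q = pair≡⇒≈ (p *ₚ q) (q *ₚ p) λ g → begin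
  pair g (p *ₚ q)                                        ≡⟨ pair-* g p q ⟩
  pair (λ a → pair (λ b → g (zipWith ℕ._+_ a b)) q) p    ≡⟨ pair-swap (λ a b → g (zipWith ℕ._+_ a b)) p q ⟩
  pair (λ b → pair (λ a → g (zipWith ℕ._+_ a b)) p) q    ≡⟨ pair-cong (λ b → pair-cong (λ a →
                                                              cong g (Vec.zipWith-comm ℕ.+-comm a b)) p) q ⟩
  pair (λ b → pair (λ a → g (zipWith ℕ._+_ b a)) p) q    ≡⟨ pair-* g q p ⟨
  pair g (q *ₚ p)                                        ∎
  where open ≡-Reasoning

*ₚ-assoc : ∀ (p q r : Poly n) → ((p *ₚ q) *ₚ r) ≈ₚ (p *ₚ (q *ₚ r))
*ₚ-assoc p q r = pair≡⇒≈ ((p *ₚ q) *ₚ r) (p *ₚ (q *ₚ r)) λ g → begin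
  pair g ((p *ₚ q) *ₚ r)
    ≡⟨ pair-* g (p *ₚ q) r ⟩
  pair (λ a → pair (λ b → g (zipWith ℕ._+_ a b)) r) (p *ₚ q)
    ≡⟨ pair-* _ p q ⟩
  pair (λ a → pair (λ b → pair (λ c → g (zipWith ℕ._+_ (zipWith ℕ._+_ a b) c)) r) q) p
    ≡⟨ pair-cong (λ a → pair-cong (λ b → pair-cong (λ c → cong g (Vec.zipWith-assoc ℕ.+-assoc a b c)) r) q) p ⟩
  pair (λ a → pair (λ b → pair (λ c → g (zipWith ℕ._+_ a (zipWith ℕ._+_ b c))) r) q) p
    ≡⟨ pair-cong (λ a → pair-* (λ b → g (zipWith ℕ._+_ a b)) q r) p ⟨
  pair (λ a → pair (λ b → g (zipWith ℕ._+_ a b)) (q *ₚ r)) p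
    ≡⟨ pair-* g p (q *ₚ r) ⟨
  pair g (p *ₚ (q *ₚ r)) ∎
  where open ≡-Reasoning

pair-const : ∀ (g : Monomial n → ℤ) c → pair g (const c) ≡ c * g (replicate _ 0)
pair-const g c = ℤ.+-identityʳ _

*ₚ-identityˡ : ∀ (p : Poly n) → (const 1ℤ *ₚ p) ≈ₚ p
*ₚ-identityˡ p = pair≡⇒≈ (const 1ℤ *ₚ p) p λ g → begin
  pair g (const 1ℤ *ₚ p)                              ≡⟨ pair-* g (const 1ℤ) p ⟩
  pair (λ a → pair (λ b → g (zipWith ℕ._+_ a b)) p) (const 1ℤ)
                                                      ≡⟨ pair-const (λ a → pair (λ b → g (zipWith ℕ._+_ a b)) p) 1ℤ ⟩
  1ℤ * pair (λ b → g (zipWith ℕ._+_ (replicate _ 0) b)) p ≡⟨ ℤ.*-identityˡ _ ⟩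
  pair (λ b → g (zipWith ℕ._+_ (replicate _ 0) b)) p  ≡⟨ pair-cong (λ b → cong g (Vec.zipWith-identityˡ ℕ.+-identityˡ b)) p ⟩
  pair g p                                            ∎
  where open ≡-Reasoning

*ₚ-cong : ∀ (p p′ q q′ : Poly n) → p ≈ₚ p′ → q ≈ₚ q′ → (p *ₚ q) ≈ₚ (p′ *ₚ q′)
*ₚ-cong p p′ q q′ p≈p′ q≈q′ = pair≡⇒≈ (p *ₚ q) (p′ *ₚ q′) λ g →
  trans (pair-* g p q)
  (trans (≈⇒pair≡ p p′ p≈p′ _)
  (trans (pair-cong (λ a → ≈⇒pair≡ q q′ q≈q′ (λ b → g (zipWith ℕ._+_ a b))) p′)
         (sym (pair-* g p′ q′))))

*ₚ-distribʳ : ∀ (p q r : Poly n) → ((q ++ r) *ₚ p) ≈ₚ ((q *ₚ p) ++ (r *ₚ p))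
*ₚ-distribʳ p q r m =
  cong (λ s → coeff s m) (List.cartesianProductWith-distribʳ-++ _*ₜ_ q r p)

++-cong : ∀ (p p′ q q′ : Poly n) → p ≈ₚ p′ → q ≈ₚ q′ → (p ++ q) ≈ₚ (p′ ++ q′)
++-cong p p′ q q′ p≈p′ q≈q′ = pair≡⇒≈ (p ++ q) (p′ ++ q′) λ g →
  trans (pair-++ g p q)
  (trans (cong₂ _+_ (≈⇒pair≡ p p′ p≈p′ g) (≈⇒pair≡ q q′ q≈q′ g)) (sym (pair-++ g p′ q′)))

-- As lists the two sides may order their terms differently. Commutativity reduces the claim to
-- `*ₚ-distribʳ`, which is an equality of lists.
*ₚ-distribˡ : ∀ (p q r : Poly n) → (p *ₚ (q ++ r)) ≈ₚ ((p *ₚ q) ++ (p *ₚ r))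
*ₚ-distribˡ p q r m = begin
  coeff (p *ₚ (q ++ r)) m            ≡⟨ *ₚ-comm p (q ++ r) m ⟩
  coeff ((q ++ r) *ₚ p) m            ≡⟨ *ₚ-distribʳ p q r m ⟩
  coeff ((q *ₚ p) ++ (r *ₚ p)) m     ≡⟨ ++-cong (q *ₚ p) (p *ₚ q) (r *ₚ p) (p *ₚ r)
                                          (*ₚ-comm q p) (*ₚ-comm r p) m ⟩
  coeff ((p *ₚ q) ++ (p *ₚ r)) m     ∎
  where open ≡-Reasoning

++-comm : ∀ (p q : Poly n) → (p ++ q) ≈ₚ (q ++ p)
++-comm p q = pair≡⇒≈ (p ++ q) (q ++ p) λ g →
  trans (pair-++ g p q) (trans (ℤ.+-comm (pair g p) _) (sym (pair-++ g q p)))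

-ₚ-cong : ∀ (p q : Poly n) → p ≈ₚ q → (-ₚ p) ≈ₚ (-ₚ q)
-ₚ-cong p q p≈q = pair≡⇒≈ (-ₚ p) (-ₚ q) λ g →
  trans (pair-neg g p) (trans (cong ℤ.-_ (≈⇒pair≡ p q p≈q g)) (sym (pair-neg g q)))

-ₚ-inverseˡ : ∀ (p : Poly n) → ((-ₚ p) ++ p) ≈ₚ []
-ₚ-inverseˡ p = pair≡⇒≈ ((-ₚ p) ++ p) [] λ g →
  trans (pair-++ g (-ₚ p) p)
  (trans (cong (λ x → x + pair g p) (pair-neg g p)) (ℤ.+-inverseˡ (pair g p)))

≈ₚ-isEquivalence : IsEquivalence (_≈ₚ_ {n})
≈ₚ-isEquivalence = record
  { refl  = λ _ → refl
  ; sym   = λ eq m → sym (eq m)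
  ; trans = λ eq₁ eq₂ m → trans (eq₁ m) (eq₂ m)
  }

ℤ[X]-commutativeRing : ℕ → CommutativeRing 0ℓ 0ℓ
ℤ[X]-commutativeRing n = record
  { Carrier = Poly n
  ; _≈_     = _≈ₚ_
  ; _+_     = _++_
  ; _*_     = _*ₚ_
  ; -_      = -ₚ_
  ; 0#      = []
  ; 1#      = const 1ℤ
  ; isCommutativeRing = record
    { isRing = record
      { +-isAbelianGroup = record
        { isGroup = record
          { isMonoid = record
            { isSemigroup = record
              { isMagma = record
                { isEquivalence = ≈ₚ-isEquivalence
                ; ∙-cong        = λ {p p′ q q′} → ++-cong p p′ q q′
                }
              ; assoc   = λ p q r m → cong (λ s → coeff s m) (List.++-assoc p q r)
              }
            ; identity = (λ p m → refl) , λ p m → cong (λ s → coeff s m) (List.++-identityʳ p)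
            }
          ; inverse = -ₚ-inverseˡ , λ p m → trans (++-comm p (-ₚ p) m) (-ₚ-inverseˡ p m)
          ; ⁻¹-cong = λ {p q} → -ₚ-cong p q
          }
        ; comm = ++-comm
        }
      ; *-cong     = λ {p p′ q q′} → *ₚ-cong p p′ q q′
      ; *-assoc    = *ₚ-assoc
      ; *-identity = *ₚ-identityˡ ,
                     λ p m → trans (*ₚ-comm p (const 1ℤ) m) (*ₚ-identityˡ p m)
      ; distrib    = *ₚ-distribˡ , *ₚ-distribʳ
      }
    ; *-comm = *ₚ-comm
    }
  }

-- Evaluations and ideals

-- Lets the ring solver work in ℤ[X] with integer coefficients, as the determinant identities
-- require.
const-morphism : ∀ n → ℤ.+-*-rawRing -Raw-AlmostCommutative⟶ fromCommutativeRing (ℤ[X]-commutativeRing n)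
const-morphism n = record
  { ⟦_⟧    = const
  ; +-homo = λ c d → pair≡⇒≈ (const (c + d)) (const c ++ const d) λ g →
      trans (pair-const g (c + d))
      (trans (ℤ.*-distribʳ-+ (g (replicate n 0)) c d)
      (cong (_+_ (c * g (replicate n 0))) (sym (pair-const g d))))
  ; *-homo = λ c d m → cong (λ a → coeff ((c * d , a) ∷ []) m)
      (sym (Vec.zipWith-replicate ℕ._+_ 0 0))
  ; -‿homo = λ c m → refl
  ; 0-homo = pair≡⇒≈ (const 0ℤ) [] λ g → pair-const g 0ℤ
  ; 1-homo = λ m → refl
  }

monomial : (Fin n → ℤ) → Monomial n → ℤ
monomial x []      = 1ℤ
monomial x (e ∷ a) = x zero ℤ.^ e * monomial (x ∘ suc) a

monomial-0 : ∀ (x : Fin n → ℤ) → monomial x (replicate n 0) ≡ 1ℤ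
monomial-0 {zero}  x = refl
monomial-0 {suc n} x = trans (ℤ.*-identityˡ _) (monomial-0 (x ∘ suc))

monomial-+ : ∀ (x : Fin n → ℤ) a b →
  monomial x (zipWith ℕ._+_ a b) ≡ monomial x a * monomial x b
monomial-+ x []      []      = refl
monomial-+ x (d ∷ a) (e ∷ b) = trans
  (cong₂ _*_ (ℤ.^-distribˡ-+-* (x zero) d e) (monomial-+ (x ∘ suc) a b))
  (interchange (x zero ℤ.^ d) (x zero ℤ.^ e) _ _)
  where open CommutativeSemigroupProperties ℤ.*-commutativeSemigroup using (interchange)

monomial-var : ∀ (x : Fin n → ℤ) i → monomial x (replicate n 0 [ i ]≔ 1) ≡ x i
monomial-var x zero    =
  trans (cong₂ _*_ (ℤ.*-identityʳ (x zero)) (monomial-0 (x ∘ suc))) (ℤ.*-identityʳ (x zero))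
monomial-var x (suc i) = trans (ℤ.*-identityˡ _) (monomial-var (x ∘ suc) i)

eval : (Fin n → ℤ) → Poly n → ℤ
eval x = pair (monomial x)

eval-const : ∀ (x : Fin n → ℤ) c → eval x (const c) ≡ c
eval-const x c = trans (pair-const (monomial x) c)
  (trans (cong (c *_) (monomial-0 x)) (ℤ.*-identityʳ c))

eval-var : ∀ (x : Fin n → ℤ) i → eval x (var i) ≡ x i
eval-var x i = trans (ℤ.+-identityʳ _) (trans (ℤ.*-identityˡ _) (monomial-var x i))

eval-* : ∀ (x : Fin n → ℤ) p q → eval x (p *ₚ q) ≡ eval x p * eval x q
eval-* x p q = begin
  eval x (p *ₚ q)
    ≡⟨ pair-* (monomial x) p q ⟩
  pair (λ a → pair (λ b → monomial x (zipWith ℕ._+_ a b)) q) p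
    ≡⟨ pair-cong (λ a → pair-cong (monomial-+ x a) q) p ⟩
  pair (λ a → pair (λ b → monomial x a * monomial x b) q) p
    ≡⟨ pair-cong (λ a → trans (pair-scale (monomial x a) (monomial x) q) (ℤ.*-comm (monomial x a) _)) p ⟩
  pair (λ a → eval x q * monomial x a) p
    ≡⟨ pair-scale (eval x q) (monomial x) p ⟩
  eval x q * eval x p
    ≡⟨ ℤ.*-comm (eval x q) _ ⟩
  eval x p * eval x q ∎
  where open ≡-Reasoning

eval-isRingHomomorphism : ∀ (x : Fin n → ℤ) →
  RingMorphisms.IsRingHomomorphism (ℤ[X] n) ℤ.+-*-rawRing (eval x)
eval-isRingHomomorphism x = record
  { isSemiringHomomorphism = record
    { isNearSemiringHomomorphism = record
      { +-isMonoidHomomorphism = record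
        { isMagmaHomomorphism = record
          { isRelHomomorphism = record { cong = λ {p q} p≈q → ≈⇒pair≡ p q p≈q (monomial x) }
          ; homo = pair-++ (monomial x)
          }
        ; ε-homo = refl
        }
      ; *-homo = eval-* x
      }
    ; 1#-homo = eval-const x 1ℤ
    }
  ; -‿homo = pair-neg (monomial x)
  }

module _ {c ℓ} (R : RawRing c ℓ) where
  open RawRing R using (Carrier; -_; 1#)
  open RawSemiringDefinitions (RawRing.rawSemiring R) using (sum; _^_)

  Ideal-minimal : ∀ {a b} {S : Pred Carrier a} {T : Pred Carrier b} →
    S ⊆ Ideal⟨_⟩ R T → Ideal⟨_⟩ R S ⊆ Ideal⟨_⟩ R T
  Ideal-minimal S⊆I (gen p∈S)    = S⊆I p∈S
  Ideal-minimal S⊆I zer          = zer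
  Ideal-minimal S⊆I (add p q)    = add (Ideal-minimal S⊆I p) (Ideal-minimal S⊆I q)
  Ideal-minimal S⊆I (mul p q)    = mul p (Ideal-minimal S⊆I q)
  Ideal-minimal S⊆I (resp p≈q p) = resp p≈q (Ideal-minimal S⊆I p)

  Ideal-sum : ∀ {a} {S : Pred Carrier a} {k} (f : Fin k → Carrier) →
    (∀ i → Ideal⟨_⟩ R S (f i)) → Ideal⟨_⟩ R S (sum f)
  Ideal-sum {k = zero}  f f∈I = zer
  Ideal-sum {k = suc k} f f∈I = add (f∈I zero) (Ideal-sum (f ∘ suc) (f∈I ∘ suc))

  punchIn-mono-< : ∀ {k} (i : Fin (suc k)) → Monotonic₁ Fin._<_ Fin._<_ (punchIn i)
  punchIn-mono-< i {j} {l} j<l =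
    ℕ.≰⇒> λ ↑l≤↑j → ℕ.<⇒≱ j<l (Fin.punchIn-cancel-≤ i l j ↑l≤↑j)

  -- The expansion along the first row.
  Minor-suc : ∀ {m n} (M : Matrix R m n) k →
    Minor R M (suc k) ⊆ Ideal⟨_⟩ R (Minor R M k)
  Minor-suc M k (r , s , r-mono , s-mono , refl) = Ideal-sum _ λ j →
    mul ((- 1#) ^ toℕ j) (mul (M (r zero) (s j)) (gen (r ∘ suc , s ∘ punchIn j , (λ i<j → r-mono (s≤s i<j)) ,
                       (λ i<j → s-mono (punchIn-mono-< j i<j)) , refl)))

-- Triviality of an ideal is handled as membership of 1; `IsUnit⇔≐` translates it to the equality of
-- ideals in the definition of the co-rank.
IsUnit : Graph (Fin n) → ℕ → Set
IsUnit G k = criticalIdeal G k (const 1ℤ)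

generated-by-1 : ∀ {S : Pred (Poly n) 0ℓ} →
  Ideal⟨_⟩ (ℤ[X] n) S (const 1ℤ) → ∀ p → Ideal⟨_⟩ (ℤ[X] n) S p
generated-by-1 {n} 1∈I p = resp (CommutativeRing.*-identityʳ (ℤ[X]-commutativeRing n) p) (mul p 1∈I)

IsUnit⇔≐ : ∀ (G : Graph (Fin n)) k → IsUnit G k ⇔ (criticalIdeal G k ≐ unitIdeal)
IsUnit⇔≐ G k = mk⇔
  (λ 1∈I → (λ {p} _ → generated-by-1 (gen refl) p) , (λ {p} _ → generated-by-1 1∈I p))
  (λ (_ , unit⊆I) → unit⊆I (gen refl))

-- By `Minor-suc` the critical ideals form a descending chain, so the trivial ones are an initial
-- segment of it.
IsUnit-antitone : ∀ (G : Graph (Fin n)) {j k} → j ℕ.≤′ k → IsUnit G k → IsUnit G j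
IsUnit-antitone G ℕ.≤′-refl       1∈I = 1∈I
IsUnit-antitone {n} G (ℕ.≤′-step {k} j≤k) 1∈I =
  IsUnit-antitone G j≤k (Ideal-minimal (ℤ[X] n) (Minor-suc (ℤ[X] n) (laplacian G) k) 1∈I)

IsUnit-0 : ∀ (G : Graph (Fin n)) → IsUnit G 0
IsUnit-0 G = gen ((λ ()) , (λ ()) , (λ {}) , (λ {}) , refl)

-- Evaluation at `x` sends the generators, hence the whole ideal, to even integers, whereas it sends
-- 1 to 1. The evenness hypothesis may use that `r` is increasing, which makes it vacuous when `k`
-- exceeds `n`.
¬IsUnit : ∀ (G : Graph (Fin n)) k x (M : Fin n → Fin n → ℤ) →
  (∀ u v → eval x (laplacian G u v) ≡ M u v) →
  (∀ (r s : Fin k → Fin n) → Monotonic₁ Fin._<_ Fin._<_ r →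
    + 2 ∣ det ℤ.+-*-rawRing k (λ a b → M (r a) (s b))) →
  ¬ IsUnit G k
¬IsUnit {n} G k x M L≡M even 1∈I = contradiction
  (subst (+ 2 ∣_) (eval-const x 1ℤ) (even-on-ideal 1∈I))
  (from-no (+ 2 ∣? 1ℤ))
  where
  even-on-ideal : ∀ {p} → criticalIdeal G k p → + 2 ∣ eval x p
  even-on-ideal (gen (r , s , r-mono , _ , refl)) = subst (+ 2 ∣_)
    (sym (det-homo (ℤ[X] n) ℤ.+-*-commutativeRing (eval-isRingHomomorphism x) k λ a b → L≡M (r a) (s b)))
    (even r s r-mono)
  even-on-ideal zer = ℤ.divides 0ℤ refl
  even-on-ideal (add {p} {q} p∈I q∈I) = subst (+ 2 ∣_) (sym (pair-++ (monomial x) p q))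
    (ℤ.∣m∣n⇒∣m+n (even-on-ideal p∈I) (even-on-ideal q∈I))
  even-on-ideal (mul p {q} q∈I) = subst (+ 2 ∣_) (sym (eval-* x p q))
    (ℤ.∣n⇒∣m*n (eval x p) (even-on-ideal q∈I))
  even-on-ideal (resp {p} {q} p≈q p∈I) =
    subst (+ 2 ∣_) (≈⇒pair≡ p q p≈q (monomial x)) (even-on-ideal p∈I)

-- Blow-ups have few trivial critical ideals

-- Equal vertices are excluded, so the diagonal value `P i i` is free to say whether the vertices of
-- colour `i` form a clique or an independent set.
IsBlowup : ∀ {V : Set} {k} → Graph V → (Fin k → Fin k → Bool) → (V → Fin k) → Set
IsBlowup G P c = ∀ u v → u ≢ v → adj G u v ≡ P (c u) (c v)

weight : Bool → ℤ
weight b = ℤ.- (+ (if b then 1 else 0))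

-- The values chosen for the indeterminates make the diagonal obey the same rule as the other
-- entries.
eval-laplacian : ∀ {k} (G : Graph (Fin n)) (P : Fin k → Fin k → Bool) c → IsBlowup G P c →
  ∀ u v → eval (λ w → weight (P (c w) (c w))) (laplacian G u v) ≡ weight (P (c u) (c v))
eval-laplacian G P c blowup u v with u Fin.≟ v
... | yes refl = eval-var (λ w → weight (P (c w) (c w))) u
... | no  u≢v  = trans (eval-const (λ w → weight (P (c w) (c w))) _) (cong weight (blowup u v u≢v))

¬IsUnit-blowup : ∀ {m} (G : Graph (Fin n)) (P : Fin m → Fin m → Bool) c → IsBlowup G P c →
  ∀ k → (∀ (i j : Fin k → Fin m) → + 2 ∣ det ℤ.+-*-rawRing k (λ a b → weight (P (i a) (j b)))) →
  ¬ IsUnit G k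
¬IsUnit-blowup G P c blowup k even =
  ¬IsUnit G k _ (λ u v → weight (P (c u) (c v))) (eval-laplacian G P c blowup)
    λ r s _ → even (c ∘ r) (c ∘ s)

multipartite : Fin 3 → Fin 3 → Bool
multipartite i j = not (does (i Fin.≟ j))

-- Colour 0 is the independent set joined to the two cliques 1 and 2.
twoCliques : Fin 3 → Fin 3 → Bool
twoCliques 0F 0F = false
twoCliques 1F 2F = false
twoCliques 2F 1F = false
twoCliques _  _  = true

-- The six colours are quantified one at a time, so that `Fin.all?` decides the property by
-- computing 3⁶ determinants.
EvenMinors₃ : (Fin 3 → Fin 3 → Bool) → Set
EvenMinors₃ P = ∀ i₀ i₁ i₂ j₀ j₁ j₂ → + 2 ∣ det ℤ.+-*-rawRing 3 λ a b →
  weight (P (Vec.lookup (i₀ ∷ i₁ ∷ i₂ ∷ []) a) (Vec.lookup (j₀ ∷ j₁ ∷ j₂ ∷ []) b))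

evenMinors₃? : ∀ P → Dec (EvenMinors₃ P)
evenMinors₃? P =
  Fin.all? λ i₀ → Fin.all? λ i₁ → Fin.all? λ i₂ →
  Fin.all? λ j₀ → Fin.all? λ j₁ → Fin.all? λ j₂ → + 2 ∣? _

¬IsUnit₃ : ∀ (G : Graph (Fin n)) P c → IsBlowup G P c → EvenMinors₃ P → ¬ IsUnit G 3
¬IsUnit₃ G P c blowup even = ¬IsUnit-blowup G P c blowup 3 λ i j →
  -- A determinant of size 3 unfolds to an expression in these six values only, so the lookups agree
  -- with `i` and `j` by computation.
  even (i 0F) (i 1F) (i 2F) (j 0F) (j 1F) (j 2F)

-- A repeated colour gives two equal rows or columns and determinant 0. Otherwise the determinant is
-- that of the whole weight matrix up to sign, namely 2 or -2; the same holds for `twoCliques`.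
¬IsUnit₃-multipartite : ∀ (G : Graph (Fin n)) c → IsBlowup G multipartite c → ¬ IsUnit G 3
¬IsUnit₃-multipartite G c blowup = ¬IsUnit₃ G multipartite c blowup (from-yes (evenMinors₃? multipartite))

¬IsUnit₃-twoCliques : ∀ (G : Graph (Fin n)) c → IsBlowup G twoCliques c → ¬ IsUnit G 3
¬IsUnit₃-twoCliques G c blowup = ¬IsUnit₃ G twoCliques c blowup (from-yes (evenMinors₃? twoCliques))

¬IsUnit₂-complete : ∀ (G : Graph (Fin n)) → (∀ u v → u ≢ v → adj G u v ≡ true) → ¬ IsUnit G 2
¬IsUnit₂-complete G complete = ¬IsUnit-blowup {m = 1} G (λ _ _ → true) (λ _ → 0F) complete 2
  -- All entries evaluate to -1, so every 2×2 minor vanishes.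
  λ _ _ → ℤ.divides 0ℤ refl

¬IsUnit₁-edgeless : ∀ (G : Graph (Fin n)) → (∀ u v → u ≢ v → adj G u v ≡ false) → ¬ IsUnit G 1
¬IsUnit₁-edgeless G edgeless = ¬IsUnit-blowup {m = 1} G (λ _ _ → false) (λ _ → 0F) edgeless 1
  λ _ _ → ℤ.divides 0ℤ refl

-- Submatrices forcing trivial critical ideals

increasing₂ : ∀ (r : Fin 2 → Fin n) → r 0F Fin.< r 1F → Monotonic₁ Fin._<_ Fin._<_ r
increasing₂ r r₀<r₁ {0F} {1F} _ = r₀<r₁
increasing₂ r r₀<r₁ {1F} {1F} (s≤s ())

sort₂ : ∀ (P : (Fin 2 → Fin n) → Set) → (∀ r → P (r ∘ transpose₀₁) → P r) →
  (∀ r → Monotonic₁ Fin._<_ Fin._<_ r → P r) →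
  ∀ r → Injective _≡_ _≡_ r → P r
sort₂ P swap sorted r r-inj with Fin.<-cmp (r 0F) (r 1F)
... | tri< r₀<r₁ _ _ = sorted _ (increasing₂ _ r₀<r₁)
... | tri≈ _ r₀≡r₁ _ with () ← r-inj r₀≡r₁
... | tri> _ _ r₁<r₀ = swap _ (sorted _ (increasing₂ _ r₁<r₀))

increasing₃ : ∀ (r : Fin 3 → Fin n) → r 0F Fin.< r 1F → r 1F Fin.< r 2F →
  Monotonic₁ Fin._<_ Fin._<_ r
increasing₃ r r₀<r₁ r₁<r₂ {0F} {1F} _ = r₀<r₁
increasing₃ r r₀<r₁ r₁<r₂ {0F} {2F} _ = Fin.<-trans r₀<r₁ r₁<r₂
increasing₃ r r₀<r₁ r₁<r₂ {1F} {1F} (s≤s ())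
increasing₃ r r₀<r₁ r₁<r₂ {1F} {2F} _ = r₁<r₂
increasing₃ r r₀<r₁ r₁<r₂ {2F} {1F} (s≤s ())
increasing₃ r r₀<r₁ r₁<r₂ {2F} {2F} (s≤s (s≤s ()))

-- Sorting by adjacent transpositions: each of the six orders of three distinct indices is brought
-- to the increasing one by at most three swaps. `Minor` lists increasing selections only, while
-- forbidden submatrices come in any order.
sort₃ : ∀ (P : (Fin 3 → Fin n) → Set) →
  (∀ r → P (r ∘ transpose₀₁) → P r) → (∀ r → P (r ∘ transpose₁₂) → P r) →
  (∀ r → Monotonic₁ Fin._<_ Fin._<_ r → P r) →
  ∀ r → Injective _≡_ _≡_ r → P r
sort₃ P swap₀₁ swap₁₂ sorted r r-inj
  with Fin.<-cmp (r 0F) (r 1F) | Fin.<-cmp (r 1F) (r 2F) | Fin.<-cmp (r 0F) (r 2F)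
... | tri≈ _ r₀≡r₁ _ | _ | _ with () ← r-inj r₀≡r₁
... | _ | tri≈ _ r₁≡r₂ _ | _ with () ← r-inj r₁≡r₂
... | _ | _ | tri≈ _ r₀≡r₂ _ with () ← r-inj r₀≡r₂
... | tri< r₀<r₁ _ _ | tri< r₁<r₂ _ _ | _ = sorted _ (increasing₃ _ r₀<r₁ r₁<r₂)
... | tri< r₀<r₁ _ _ | tri> _ _ r₂<r₁ | tri< r₀<r₂ _ _ =
  swap₁₂ _ (sorted _ (increasing₃ _ r₀<r₂ r₂<r₁))
... | tri< r₀<r₁ _ _ | tri> _ _ r₂<r₁ | tri> _ _ r₂<r₀ =
  swap₁₂ _ (swap₀₁ _ (sorted _ (increasing₃ _ r₂<r₀ r₀<r₁)))
... | tri> _ _ r₁<r₀ | tri< r₁<r₂ _ _ | tri< r₀<r₂ _ _ =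
  swap₀₁ _ (sorted _ (increasing₃ _ r₁<r₀ r₀<r₂))
... | tri> _ _ r₁<r₀ | tri< r₁<r₂ _ _ | tri> _ _ r₂<r₀ =
  swap₀₁ _ (swap₁₂ _ (sorted _ (increasing₃ _ r₁<r₂ r₂<r₀)))
... | tri> _ _ r₁<r₀ | tri> _ _ r₂<r₁ | _ =
  swap₀₁ _ (swap₁₂ _ (swap₀₁ _ (sorted _ (increasing₃ _ r₂<r₁ r₁<r₀))))

module _ {n : ℕ} where
  open CommutativeRing (ℤ[X]-commutativeRing n) using (ring)
  open RingProperties ring using (-1*x≈-x; -‿involutive)
  open Determinants (ℤ[X]-commutativeRing n) (const-morphism n)

  -- Absorbs the signs of row and column swaps, and turns a minor equal to -1 into a proof of
  -- triviality.
  negated-member : ∀ {S : Pred (Poly n) 0ℓ} p q → p ≈ₚ (-ₚ q) →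
    Ideal⟨_⟩ (ℤ[X] n) S p → Ideal⟨_⟩ (ℤ[X] n) S q
  negated-member p q p≈-q p∈I = resp
    (λ m → trans (-1*x≈-x p m) (trans (-ₚ-cong p (-ₚ q) p≈-q m) (-‿involutive q m)))
    (mul (-ₚ const 1ℤ) p∈I)

  -- The rows are sorted first and then the columns; each swap changes the determinant only by a
  -- sign.
  minor₂-member : ∀ (M : Matrix (ℤ[X] n) n n) (r s : Fin 2 → Fin n) →
    Injective _≡_ _≡_ r → Injective _≡_ _≡_ s →
    Ideal⟨_⟩ (ℤ[X] n) (Minor (ℤ[X] n) M 2) (det (ℤ[X] n) 2 (λ a b → M (r a) (s b)))
  minor₂-member M r s r-inj s-inj = sort₂
    (λ r → Ideal⟨_⟩ _ _ (det (ℤ[X] n) 2 (λ a b → M (r a) (s b))))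
    (λ r → negated-member _ _ (det₂-rows₀₁ λ a b → M (r a) (s b)))
    (λ r r-mono → sort₂
      (λ s → Ideal⟨_⟩ _ _ (det (ℤ[X] n) 2 (λ a b → M (r a) (s b))))
      (λ s → negated-member _ _ (det₂-columns₀₁ λ a b → M (r a) (s b)))
      (λ s s-mono → gen (r , s , (λ {i j} → r-mono {i} {j}) , (λ {i j} → s-mono {i} {j}) , refl))
      s s-inj)
    r r-inj

  minor₃-member : ∀ (M : Matrix (ℤ[X] n) n n) (r s : Fin 3 → Fin n) →
    Injective _≡_ _≡_ r → Injective _≡_ _≡_ s →
    Ideal⟨_⟩ (ℤ[X] n) (Minor (ℤ[X] n) M 3) (det (ℤ[X] n) 3 (λ a b → M (r a) (s b)))
  minor₃-member M r s r-inj s-inj = sort₃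
    (λ r → Ideal⟨_⟩ _ _ (det (ℤ[X] n) 3 (λ a b → M (r a) (s b))))
    (λ r → negated-member _ _ (det₃-rows₀₁ λ a b → M (r a) (s b)))
    (λ r → negated-member _ _ (det₃-rows₁₂ λ a b → M (r a) (s b)))
    (λ r r-mono → sort₃
      (λ s → Ideal⟨_⟩ _ _ (det (ℤ[X] n) 3 (λ a b → M (r a) (s b))))
      (λ s → negated-member _ _ (det₃-columns₀₁ λ a b → M (r a) (s b)))
      (λ s → negated-member _ _ (det₃-columns₁₂ λ a b → M (r a) (s b)))
      (λ s s-mono → gen (r , s , (λ {i j} → r-mono {i} {j}) , (λ {i j} → s-mono {i} {j}) , refl))
      s s-inj)
    r r-inj

  module Minors (G : Graph (Fin n)) where
    -- `N` demands distinct vertices because it stands for an entry 0 of the Laplacian, whose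
    -- diagonal entries are indeterminates.
    A N : Fin n → Fin n → Set
    A u v = adj G u v ≡ true
    N u v = u ≢ v × adj G u v ≡ false

    A-sym : ∀ {u v} → A u v → A v u
    A-sym {u} {v} uv = trans (symm G v u) uv

    N-sym : ∀ {u v} → N u v → N v u
    N-sym {u} {v} (u≢v , uv) = (λ v≡u → u≢v (sym v≡u)) , trans (symm G v u) uv

    A⇒≢ : ∀ {u v} → A u v → u ≢ v
    A⇒≢ {u} uv refl with () ← trans (sym uv) (irrefl G u)

    ¬A×N : ∀ {u v} → A u v → ¬ N u v
    ¬A×N uv (_ , ¬uv) with () ← trans (sym uv) ¬uv

    laplacian-A : ∀ {u v} → A u v → laplacian G u v ≈ₚ const ℤ.-1ℤ
    laplacian-A {u} {v} uv m
      rewrite dec-false (u Fin.≟ v) (A⇒≢ uv) | uv = refl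

    laplacian-N : ∀ {u v} → N u v → laplacian G u v ≈ₚ const 0ℤ
    laplacian-N {u} {v} (u≢v , uv) m
      rewrite dec-false (u Fin.≟ v) u≢v | uv = refl

    -- The vertex `w` tells `u` and `v` apart. In this way the entries of a forbidden submatrix
    -- already force its rows and its columns to be distinct.
    A≢N : ∀ {u v w} → A w u → N w v → u ≢ v
    A≢N wu wv refl = ¬A×N wu wv

    N≢A : ∀ {u v w} → N u w → A v w → u ≢ v
    N≢A uw vw = ≢-sym (A≢N (A-sym vw) (N-sym uw))

    pick₂ : Fin n → Fin n → Fin 2 → Fin n
    pick₂ u v = Vec.lookup (u ∷ v ∷ [])

    pick₃ : Fin n → Fin n → Fin n → Fin 3 → Fin n
    pick₃ u v w = Vec.lookup (u ∷ v ∷ w ∷ [])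

    pick₂-injective : ∀ {u v} → u ≢ v → Injective _≡_ _≡_ (pick₂ u v)
    pick₂-injective u≢v {0F} {0F} _  = refl
    pick₂-injective u≢v {0F} {1F} eq = contradiction eq u≢v
    pick₂-injective u≢v {1F} {0F} eq = contradiction (sym eq) u≢v
    pick₂-injective u≢v {1F} {1F} _  = refl

    pick₃-injective : ∀ {u v w} → u ≢ v → u ≢ w → v ≢ w → Injective _≡_ _≡_ (pick₃ u v w)
    pick₃-injective u≢v u≢w v≢w {0F} {0F} _  = refl
    pick₃-injective u≢v u≢w v≢w {0F} {1F} eq = contradiction eq u≢v
    pick₃-injective u≢v u≢w v≢w {0F} {2F} eq = contradiction eq u≢w
    pick₃-injective u≢v u≢w v≢w {1F} {0F} eq = contradiction (sym eq) u≢v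
    pick₃-injective u≢v u≢w v≢w {1F} {1F} _  = refl
    pick₃-injective u≢v u≢w v≢w {1F} {2F} eq = contradiction eq v≢w
    pick₃-injective u≢v u≢w v≢w {2F} {0F} eq = contradiction (sym eq) u≢w
    pick₃-injective u≢v u≢w v≢w {2F} {1F} eq = contradiction (sym eq) v≢w
    pick₃-injective u≢v u≢w v≢w {2F} {2F} _  = refl

    adjacent⇒IsUnit₁ : ∀ {u v} → A u v → IsUnit G 1
    adjacent⇒IsUnit₁ {u} {v} uv = negated-member (det (ℤ[X] n) 1 λ _ _ → laplacian G u v) (const 1ℤ)
      (det₁-entry (λ _ _ → laplacian G u v) (laplacian-A uv))
      (gen ((λ _ → u) , (λ _ → v) , (λ { {0F} {0F} () }) , (λ { {0F} {0F} () }) , refl))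

    -- With rows `u`, `v` and columns `v`, `w` the indeterminate of `v` lies below the diagonal, and
    -- the minor is 1.
    path⇒IsUnit₂ : ∀ {u v w} → A u v → A v w → N u w → IsUnit G 2
    path⇒IsUnit₂ {u} {v} {w} uv vw uw = resp
      (det₂-triangular (λ a b → laplacian G (pick₂ u v a) (pick₂ v w b))
        (laplacian-A uv) (laplacian-N uw) (laplacian-A vw))
      (minor₂-member (laplacian G) (pick₂ u v) (pick₂ v w)
        (pick₂-injective (A⇒≢ uv)) (pick₂-injective (A⇒≢ vw)))

    -- P₄, the cricket and the dart contain such a submatrix.
    triangular⇒IsUnit₃ : ∀ {r₀ r₁ r₂ s₀ s₁ s₂} →
      A r₀ s₀ → A r₁ s₁ → A r₂ s₂ → N r₀ s₁ → N r₀ s₂ → N r₁ s₂ → IsUnit G 3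
    triangular⇒IsUnit₃ {r₀} {r₁} {r₂} {s₀} {s₁} {s₂} r₀s₀ r₁s₁ r₂s₂ r₀s₁ r₀s₂ r₁s₂ =
      negated-member _ (const 1ℤ)
        (det₃-triangular (λ a b → laplacian G (pick₃ r₀ r₁ r₂ a) (pick₃ s₀ s₁ s₂ b))
          (laplacian-A r₀s₀) (laplacian-A r₁s₁) (laplacian-A r₂s₂)
          (laplacian-N r₀s₁) (laplacian-N r₀s₂) (laplacian-N r₁s₂))
        (minor₃-member (laplacian G) (pick₃ r₀ r₁ r₂) (pick₃ s₀ s₁ s₂)
          (pick₃-injective (N≢A r₀s₁ r₁s₁) (N≢A r₀s₂ r₂s₂) (N≢A r₁s₂ r₂s₂))
          (pick₃-injective (A≢N r₀s₀ r₀s₁) (A≢N r₀s₀ r₀s₂) (A≢N r₁s₁ r₁s₂)))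

    -- K₅ minus two adjacent edges and K₆ minus two disjoint edges contain such
    -- a submatrix; its entry (r₁ , s₀) is arbitrary.
    near-triangular⇒IsUnit₃ : ∀ {r₀ r₁ r₂ s₀ s₁ s₂} →
      N r₀ s₀ → N r₁ s₁ → A r₀ s₁ → A r₀ s₂ → A r₁ s₂ → A r₂ s₀ → A r₂ s₁ → A r₂ s₂ → IsUnit G 3
    near-triangular⇒IsUnit₃ {r₀} {r₁} {r₂} {s₀} {s₁} {s₂} r₀s₀ r₁s₁ r₀s₁ r₀s₂ r₁s₂ r₂s₀ r₂s₁ r₂s₂ =
      negated-member _ (const 1ℤ)
        (det₃-near-triangular (λ a b → laplacian G (pick₃ r₀ r₁ r₂ a) (pick₃ s₀ s₁ s₂ b))
          (laplacian-N r₀s₀) (laplacian-N r₁s₁) (laplacian-A r₀s₁) (laplacian-A r₀s₂)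
          (laplacian-A r₁s₂) (laplacian-A r₂s₀) (laplacian-A r₂s₁) (laplacian-A r₂s₂))
        (minor₃-member (laplacian G) (pick₃ r₀ r₁ r₂) (pick₃ s₀ s₁ s₂)
          (pick₃-injective (≢-sym (N≢A r₁s₁ r₀s₁)) (N≢A r₀s₀ r₂s₀) (N≢A r₁s₁ r₂s₁))
          (pick₃-injective (≢-sym (A≢N r₀s₁ r₀s₀)) (≢-sym (A≢N r₀s₂ r₀s₀)) (≢-sym (A≢N r₁s₂ r₁s₁))))

-- Graphs with non-trivial third critical ideal

module Structure {n : ℕ} (G : Graph (Fin n)) (connected : Connected G) (¬unit : ¬ IsUnit G 3) where
  open Minors G

  data Relation (u v : Fin n) : Set where
    equal       : u ≡ v → Relation u v
    adjacent    : A u v → Relation u v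
    nonadjacent : N u v → Relation u v

  relation : ∀ u v → Relation u v
  relation u v with u Fin.≟ v | adj G u v in uv
  ... | yes u≡v | _     = equal u≡v
  ... | no  _   | true  = adjacent uv
  ... | no  u≢v | false = nonadjacent (u≢v , uv)

  A-by-refuting-N : ∀ {u v} → u ≢ v → ¬ N u v → A u v
  A-by-refuting-N {u} {v} u≢v ¬uv with relation u v
  ... | equal u≡v      = contradiction u≡v u≢v
  ... | adjacent uv    = uv
  ... | nonadjacent uv = contradiction uv ¬uv

  N-by-refuting-A : ∀ {u v} → u ≢ v → ¬ A u v → N u v
  N-by-refuting-A {u} {v} u≢v ¬uv with relation u v
  ... | equal u≡v      = contradiction u≡v u≢v
  ... | adjacent uv    = contradiction uv ¬uv
  ... | nonadjacent uv = uv

  no-triangular : ∀ {r₀ r₁ r₂ s₀ s₁ s₂} →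
    A r₀ s₀ → A r₁ s₁ → A r₂ s₂ → N r₀ s₁ → N r₀ s₂ → ¬ N r₁ s₂
  no-triangular r₀s₀ r₁s₁ r₂s₂ r₀s₁ r₀s₂ r₁s₂ =
    ¬unit (triangular⇒IsUnit₃ r₀s₀ r₁s₁ r₂s₂ r₀s₁ r₀s₂ r₁s₂)

  -- The triangular submatrix has rows `a`, `b`, `c` and columns `b`, `c`, `d`.
  no-P₄ : ∀ {a b c d} → A a b → A b c → A c d → N a c → N a d → ¬ N b d
  no-P₄ = no-triangular

  Near : Fin n → Fin n → Set
  Near u v = u ≡ v ⊎ A u v ⊎ (∃[ w ] (A u w × A w v))

  -- A walk of three edges that admits no shortcut would be an induced P₄, so distance at most 2
  -- persists along any walk.
  near-step : ∀ {u w v} → A u w → Near w v → Near u v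
  near-step uw (inj₁ refl)                   = inj₂ (inj₁ uw)
  near-step uw (inj₂ (inj₁ wv))              = inj₂ (inj₂ (_ , uw , wv))
  near-step {u} {w} {v} uw (inj₂ (inj₂ (x , wx , xv))) with relation u v | relation u x | relation w v
  ... | equal u≡v      | _              | _              = inj₁ u≡v
  ... | adjacent uv    | _              | _              = inj₂ (inj₁ uv)
  ... | _              | equal refl     | _              = inj₂ (inj₁ xv)
  ... | _              | adjacent ux    | _              = inj₂ (inj₂ (x , ux , xv))
  ... | _              | _              | equal refl     = inj₂ (inj₁ uw)
  ... | _              | _              | adjacent wv    = inj₂ (inj₂ (w , uw , wv))
  ... | nonadjacent uv | nonadjacent ux | nonadjacent wv = ⊥-elim (no-P₄ uw wx xv ux uv wv)

  near : ∀ {u v} → Star (Adj G) u v → Near u v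
  near ε         = inj₁ refl
  near (uw ◅ wv) = near-step (Equivalence.to Bool.T-≡ uw) (near wv)

  common-neighbour : ∀ {u v} → N u v → ∃[ w ] (A u w × A w v)
  common-neighbour {u} {v} uv with near (connected u v)
  ... | inj₁ refl             = contradiction refl (proj₁ uv)
  ... | inj₂ (inj₁ uv′)       = contradiction uv (¬A×N uv′)
  ... | inj₂ (inj₂ neighbour) = neighbour

  module TwoCliques {u v w : Fin n} (vu : N v u) (vw : N v w) (uw : A u w) where
    -- `u` and `v` represent the two cliques, and a vertex adjacent to both belongs to the
    -- independent set. The indices are the colours of `twoCliques`.
    data Class (x : Fin n) : Fin 3 → Set where
      joined : A x u → A x v → Class x 0F
      with-u : x ≡ u ⊎ A x u → N x v → Class x 1F
      with-v : x ≡ v ⊎ A x v → N x u → Class x 2F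

    joined⇒A-w : ∀ {x} → A x u → A x v → A x w
    joined⇒A-w xu xv = A-by-refuting-N (A≢N (A-sym xv) vw) λ xw →
      no-P₄ (A-sym xv) xu uw vu vw xw

    centre : ∃[ s ] (A v s × A s u)
    centre = common-neighbour vu

    classify : ∀ x → ∃[ i ] Class x i
    classify x with relation x u | relation x v
    ... | equal refl     | _              = 1F , with-u (inj₁ refl) (N-sym vu)
    ... | nonadjacent xu | equal refl     = 2F , with-v (inj₁ refl) xu
    ... | adjacent xu    | equal refl     = contradiction vu (¬A×N xu)
    ... | adjacent xu    | adjacent xv    = 0F , joined xu xv
    ... | adjacent xu    | nonadjacent xv = 1F , with-u (inj₂ xu) xv
    ... | nonadjacent xu | adjacent xv    = 2F , with-v (inj₂ xv) xu
    ... | nonadjacent xu | nonadjacent xv = ⊥-elim (impossible centre (common-neighbour xu))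
      where
      impossible : ∃[ s ] (A v s × A s u) → ¬ (∃[ y ] (A x y × A y u))
      impossible (s , vs , su) (y , xy , _) with relation x s
      ... | equal refl     = ¬A×N su xu
      -- Rows `v`, `u`, `s` and columns `s`, `w`, `x`: since `s` is also adjacent to `w`, this is a
      -- cricket or a dart, according to whether `x` and `w` are adjacent.
      ... | adjacent xs    = no-triangular vs uw (A-sym xs) vw (N-sym xv) (N-sym xu)
      -- Rows `x`, `v`, `s` and columns `y`, `s`, `u`; the neighbour `y` supplies the entry -1 in
      -- row `x`.
      ... | nonadjacent xs = no-triangular xy vs su xs xu vu

    joined~joined : ∀ {x y} → x ≢ y → A x u → A x v → A y u → A y v → adj G x y ≡ false
    joined~joined x≢y xu xv yu yv = proj₂ (N-by-refuting-A x≢y λ xy →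
      -- Rows `u`, `v`, `x` and columns `v`, `w`, `y` of a K₅ lacking the edges `vu` and `vw`; the
      -- arbitrary entry is the indeterminate of `v`.
      ¬unit (near-triangular⇒IsUnit₃ (N-sym vu) vw uw (A-sym yu) (A-sym yv) xv (joined⇒A-w xu xv) xy))

    joined~u : ∀ {x y} → x ≢ y → A x u → A x v → y ≡ u ⊎ A y u → N y v → A x y
    joined~u x≢y xu xv (inj₁ refl) yv = xu
    joined~u x≢y xu xv (inj₂ yu)   yv = A-by-refuting-N x≢y
      (no-P₄ (A-sym xv) xu (A-sym yu) vu (N-sym yv))

    joined~v : ∀ {x y} → x ≢ y → A x u → A x v → y ≡ v ⊎ A y v → N y u → A x y
    joined~v x≢y xu xv (inj₁ refl) yu = xv
    joined~v x≢y xu xv (inj₂ yv)   yu = A-by-refuting-N x≢y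
      (no-P₄ (A-sym xu) xv (A-sym yv) (N-sym vu) (N-sym yu))

    u~u : ∀ {x y} → x ≢ y → x ≡ u ⊎ A x u → y ≡ u ⊎ A y u → N y v → A x y
    u~u x≢y (inj₁ refl) (inj₁ refl) yv = contradiction refl x≢y
    u~u x≢y (inj₁ refl) (inj₂ yu)   yv = A-sym yu
    u~u x≢y (inj₂ xu)   (inj₁ refl) yv = xu
    u~u x≢y (inj₂ xu)   (inj₂ yu)   yv = A-by-refuting-N x≢y
      -- Rows `v`, `x`, `u` and columns `s`, `u`, `y`, where `s` is the common neighbour of `v` and
      -- `u` given by `centre`.
      (no-triangular (proj₁ (proj₂ centre)) xu (A-sym yu) vu (N-sym yv))

    v~v : ∀ {x y} → x ≢ y → x ≡ v ⊎ A x v → y ≡ v ⊎ A y v → N y u → A x y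
    v~v x≢y (inj₁ refl) (inj₁ refl) yu = contradiction refl x≢y
    v~v x≢y (inj₁ refl) (inj₂ yv)   yu = A-sym yv
    v~v x≢y (inj₂ xv)   (inj₁ refl) yu = xv
    v~v x≢y (inj₂ xv)   (inj₂ yv)   yu = A-by-refuting-N x≢y
      (no-triangular (A-sym (proj₂ (proj₂ centre))) xv (A-sym yv) (N-sym vu) (N-sym yu))

    u~v : ∀ {x y} → x ≢ y → x ≡ u ⊎ A x u → N x v → y ≡ v ⊎ A y v → N y u → adj G x y ≡ false
    u~v x≢y (inj₁ refl) xv _           yu = proj₂ (N-sym yu)
    u~v x≢y (inj₂ _)    xv (inj₁ refl) yu = proj₂ xv
    u~v x≢y (inj₂ xu)   xv (inj₂ yv)   yu = proj₂ (N-by-refuting-A x≢y λ xy →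
      no-P₄ (A-sym yv) (A-sym xy) xu (N-sym xv) vu yu)

    compatible : ∀ {x y i j} → x ≢ y → Class x i → Class y j → adj G x y ≡ twoCliques i j
    compatible x≢y (joined xu xv) (joined yu yv) = joined~joined x≢y xu xv yu yv
    compatible x≢y (joined xu xv) (with-u yu yv) = joined~u x≢y xu xv yu yv
    compatible x≢y (joined xu xv) (with-v yv yu) = joined~v x≢y xu xv yv yu
    compatible x≢y (with-u xu xv) (joined yu yv) = A-sym (joined~u (≢-sym x≢y) yu yv xu xv)
    compatible x≢y (with-u xu _)  (with-u yu yv) = u~u x≢y xu yu yv
    compatible x≢y (with-u xu xv) (with-v yv yu) = u~v x≢y xu xv yv yu
    compatible x≢y (with-v xv xu) (joined yu yv) = A-sym (joined~v (≢-sym x≢y) yu yv xv xu)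
    compatible x≢y (with-v xv xu) (with-u yu yv) = trans (symm G _ _) (u~v (≢-sym x≢y) yu yv xv xu)
    compatible x≢y (with-v xv _)  (with-v yv yu) = v~v x≢y xv yv yu

    blowup : ∃[ c ] IsBlowup G twoCliques c
    blowup = (λ x → proj₁ (classify x)) , λ x y x≢y →
      compatible x≢y (proj₂ (classify x)) (proj₂ (classify y))

  module Multipartite
    (¬2cliques : ∀ {u v w} → N v u → N v w → ¬ A u w) where

    -- Unlike `N`, this holds on the diagonal too, so it becomes an equivalence relation whose
    -- classes are the parts.
    F : Fin n → Fin n → Set
    F u v = adj G u v ≡ false

    F-sym : ∀ {u v} → F u v → F v u
    F-sym {u} {v} uv = trans (symm G v u) uv

    ¬A×F : ∀ {u v} → A u v → ¬ F u v
    ¬A×F uv ¬uv with () ← trans (sym uv) ¬uv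

    -- Otherwise `w` would be adjacent to neither end of the edge `uv`.
    A-respʳ : ∀ {u v w} → A u v → F v w → A u w
    A-respʳ {u} {v} {w} uv vw with relation u w
    ... | equal refl     = contradiction (F-sym vw) (¬A×F uv)
    ... | adjacent uw    = uw
    ... | nonadjacent uw with relation v w
    ...   | equal refl       = uv
    ...   | adjacent vw′     = contradiction vw (¬A×F vw′)
    ...   | nonadjacent vw′  = contradiction uv (¬2cliques (N-sym uw) (N-sym vw′))

    A-respˡ : ∀ {u v w} → A u v → F u w → A w v
    A-respˡ uv uw = A-sym (A-respʳ (A-sym uv) uw)

    F-trans : ∀ {u v w} → F u v → F v w → F u w
    F-trans {u} {v} {w} uv vw with adj G u w in uw
    ... | false = refl
    ... | true  = contradiction uv (¬A×F (A-respʳ uw (F-sym vw)))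

    module ThreeParts {p q x y : Fin n} (pq : N p q) (xy : N x y) (xp : A x p) where
      data Class (z : Fin n) : Fin 3 → Set where
        part-p : F z p → Class z 0F
        part-x : F z x → Class z 1F
        rest   : A z p → A z x → Class z 2F

      classify : ∀ z → ∃[ i ] Class z i
      classify z with adj G z p in zp | adj G z x in zx
      ... | false | _     = 0F , part-p zp
      ... | true  | false = 1F , part-x zx
      ... | true  | true  = 2F , rest zp zx

      compatible : ∀ {z t i j} → z ≢ t → Class z i → Class t j → adj G z t ≡ multipartite i j
      compatible z≢t (part-p zp) (part-p tp)   = F-trans zp (F-sym tp)
      compatible z≢t (part-p zp) (part-x tx)   = A-respʳ (A-respˡ (A-sym xp) (F-sym zp)) (F-sym tx)
      compatible z≢t (part-p zp) (rest tp _)   = A-respˡ (A-sym tp) (F-sym zp)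
      compatible z≢t (part-x zx) (part-x tx)   = F-trans zx (F-sym tx)
      compatible z≢t (part-x zx) (rest _ tx)   = A-respˡ (A-sym tx) (F-sym zx)
      compatible z≢t (rest zp zx) (rest tp tx) = proj₂ (N-by-refuting-A z≢t λ zt →
        -- Rows `p`, `x`, `z` and columns `q`, `y`, `t` of a K₆ lacking the edges `pq` and `xy`.
        -- Hence the vertices outside the parts of `p` and `x` are independent and form the third
        -- part.
        ¬unit (near-triangular⇒IsUnit₃ pq xy
          (A-respʳ (A-sym xp) (proj₂ xy)) (A-sym tp) (A-sym tx)
          (A-respʳ zp (proj₂ pq)) (A-respʳ zx (proj₂ xy)) zt))
      compatible z≢t (part-x zx) (part-p tp)   = A-sym (A-respʳ (A-respˡ (A-sym xp) (F-sym tp)) (F-sym zx))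
      compatible z≢t (rest zp _) (part-p tp)   = A-respʳ zp (F-sym tp)
      compatible z≢t (rest _ zx) (part-x tx)   = A-respʳ zx (F-sym tx)

      blowup : ∃[ c ] IsBlowup G multipartite c
      blowup = (λ z → proj₁ (classify z)) , λ z t z≢t →
        compatible z≢t (proj₂ (classify z)) (proj₂ (classify t))

    -- No part other than that of `p` has two vertices, so the remaining vertices form a clique. The
    -- second clique of `twoCliques` stays empty.
    module OnePart {p q : Fin n} (pq : N p q) (¬3parts : ∀ {x y} → N x y → ¬ A x p) where
      data Class (z : Fin n) : Fin 3 → Set where
        part : F z p → Class z 0F
        rest : A z p → Class z 1F

      classify : ∀ z → ∃[ i ] Class z i
      classify z with adj G z p in zp
      ... | false = 0F , part zp
      ... | true  = 1F , rest zp

      compatible : ∀ {z t i j} → z ≢ t → Class z i → Class t j → adj G z t ≡ twoCliques i j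
      compatible z≢t (part zp) (part tp) = F-trans zp (F-sym tp)
      compatible z≢t (part zp) (rest tp) = A-respˡ (A-sym tp) (F-sym zp)
      compatible z≢t (rest zp) (part tp) = A-respʳ zp (F-sym tp)
      compatible z≢t (rest zp) (rest tp) = A-by-refuting-N z≢t λ zt → ¬3parts zt zp

      blowup : ∃[ c ] IsBlowup G twoCliques c
      blowup = (λ z → proj₁ (classify z)) , λ z t z≢t →
        compatible z≢t (proj₂ (classify z)) (proj₂ (classify t))

  A? : ∀ u v → Dec (A u v)
  A? u v = adj G u v Bool.≟ true

  N? : ∀ u v → Dec (N u v)
  N? u v = ¬? (u Fin.≟ v) ×-dec (adj G u v Bool.≟ false)

  structure : (∃[ c ] IsBlowup G multipartite c) ⊎ (∃[ c ] IsBlowup G twoCliques c)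
  structure with Fin.any? (λ u → Fin.any? λ v → Fin.any? λ w → N? v u ×-dec N? v w ×-dec A? u w)
  ... | yes (u , v , w , vu , vw , uw) = inj₂ (TwoCliques.blowup vu vw uw)
  ... | no ¬2cliques
    with Fin.any? (λ p → Fin.any? λ q → Fin.any? λ x → Fin.any? λ y → N? p q ×-dec N? x y ×-dec A? x p)
  ...   | yes (p , q , x , y , pq , xy , xp) = inj₁ (
    Multipartite.ThreeParts.blowup (λ vu vw uw → ¬2cliques (_ , _ , _ , vu , vw , uw)) pq xy xp)
  ...   | no ¬3parts with Fin.any? (λ p → Fin.any? λ q → N? p q)
  ...     | yes (p , q , pq) = inj₂ (
    Multipartite.OnePart.blowup (λ vu vw uw → ¬2cliques (_ , _ , _ , vu , vw , uw)) pq
      (λ xy xp → ¬3parts (_ , _ , _ , _ , pq , xy , xp)))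
  -- Without non-adjacent pairs the graph is complete, that is, a single clique.
  ...     | no complete = inj₂ ((λ _ → 1F) , λ u v u≢v →
    A-by-refuting-N u≢v λ uv → complete (_ , _ , uv))

-- Induced subgraphs and the co-rank

pullback-blowup : ∀ {k} (G : Graph V) (H : Graph W) (P : Fin k → Fin k → Bool) c →
  IsBlowup H P c → G IsInducedSubgraphOf H → ∃[ c ] IsBlowup G P c
pullback-blowup G H P c blowup (f , f-inj , f-adj) = c ∘ f , λ u v u≢v →
  trans (f-adj u v) (blowup (f u) (f v) (u≢v ∘ f-inj))

-- Each colour receives its own copy of the whole vertex set, so three parts as large as the graph
-- always suffice, and injectivity follows by forgetting the colour.
place : Fin 3 → V → V ⊎ V ⊎ V
place 0F v = inj₁ v
place 1F v = inj₂ (inj₁ v)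
place 2F v = inj₂ (inj₂ v)

unplace : V ⊎ V ⊎ V → V
unplace (inj₁ v)        = v
unplace (inj₂ (inj₁ v)) = v
unplace (inj₂ (inj₂ v)) = v

unplace-place : ∀ i (v : V) → unplace (place i v) ≡ v
unplace-place 0F v = refl
unplace-place 1F v = refl
unplace-place 2F v = refl

colour : ∀ {A B C : Set} → A ⊎ B ⊎ C → Fin 3
colour (inj₁ _)        = 0F
colour (inj₂ (inj₁ _)) = 1F
colour (inj₂ (inj₂ _)) = 2F

colour-place : ∀ i (v : V) → colour (place i v) ≡ i
colour-place 0F v = refl
colour-place 1F v = refl
colour-place 2F v = refl

blowup⇒induced : ∀ (G : Graph (Fin n)) (H : Graph (Fin n ⊎ Fin n ⊎ Fin n)) P →
  IsBlowup H P colour → ∃[ c ] IsBlowup G P c → G IsInducedSubgraphOf H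
blowup⇒induced {n} G H P H-blowup (c , G-blowup) = f , f-inj , f-adj
  where
  f : Fin n → Fin n ⊎ Fin n ⊎ Fin n
  f v = place (c v) v

  f-inj : Injective _≡_ _≡_ f
  f-inj {u} {v} fu≡fv =
    trans (sym (unplace-place (c u) u)) (trans (cong unplace fu≡fv) (unplace-place (c v) v))

  f-adj : ∀ u v → adj G u v ≡ adj H (f u) (f v)
  f-adj u v with u Fin.≟ v
  -- `IsBlowup` is silent about equal vertices, so the diagonal is settled by irreflexivity.
  ... | yes refl = trans (irrefl G u) (sym (irrefl H (f u)))
  ... | no  u≢v  = begin
    adj G u v                           ≡⟨ G-blowup u v u≢v ⟩
    P (c u) (c v)                       ≡⟨ cong₂ P (colour-place (c u) u) (colour-place (c v) v) ⟨
    P (colour (f u)) (colour (f v))     ≡⟨ H-blowup (f u) (f v) (u≢v ∘ f-inj) ⟨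
    adj H (f u) (f v)                   ∎
    where open ≡-Reasoning

complete-adj : ∀ n {u v} → u ≢ v → adj (complete n) u v ≡ true
complete-adj n {u} {v} u≢v = cong not (dec-false (u Fin.≟ v) u≢v)

completeTripartite-blowup : ∀ m n o → IsBlowup (completeTripartite m n o) multipartite colour
completeTripartite-blowup m n o (inj₁ _)        (inj₁ _)        _ = refl
completeTripartite-blowup m n o (inj₁ _)        (inj₂ (inj₁ _)) _ = refl
completeTripartite-blowup m n o (inj₁ _)        (inj₂ (inj₂ _)) _ = refl
completeTripartite-blowup m n o (inj₂ (inj₁ _)) (inj₁ _)        _ = refl
completeTripartite-blowup m n o (inj₂ (inj₁ _)) (inj₂ (inj₁ _)) _ = refl
completeTripartite-blowup m n o (inj₂ (inj₁ _)) (inj₂ (inj₂ _)) _ = refl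
completeTripartite-blowup m n o (inj₂ (inj₂ _)) (inj₁ _)        _ = refl
completeTripartite-blowup m n o (inj₂ (inj₂ _)) (inj₂ (inj₁ _)) _ = refl
completeTripartite-blowup m n o (inj₂ (inj₂ _)) (inj₂ (inj₂ _)) _ = refl

joinOfCliques-blowup : ∀ m n o → IsBlowup (edgeless n ∨ (complete m ∔ complete o)) twoCliques colour
joinOfCliques-blowup m n o (inj₁ _)        (inj₁ _)        _   = refl
joinOfCliques-blowup m n o (inj₁ _)        (inj₂ (inj₁ _)) _   = refl
joinOfCliques-blowup m n o (inj₁ _)        (inj₂ (inj₂ _)) _   = refl
joinOfCliques-blowup m n o (inj₂ (inj₁ _)) (inj₁ _)        _   = refl
joinOfCliques-blowup m n o (inj₂ (inj₁ u)) (inj₂ (inj₁ v)) u≢v =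
  complete-adj m (u≢v ∘ cong (inj₂ ∘ inj₁))
joinOfCliques-blowup m n o (inj₂ (inj₁ _)) (inj₂ (inj₂ _)) _   = refl
joinOfCliques-blowup m n o (inj₂ (inj₂ _)) (inj₁ _)        _   = refl
joinOfCliques-blowup m n o (inj₂ (inj₂ _)) (inj₂ (inj₁ _)) _   = refl
joinOfCliques-blowup m n o (inj₂ (inj₂ u)) (inj₂ (inj₂ v)) u≢v =
  complete-adj o (u≢v ∘ cong (inj₂ ∘ inj₂))

-- Co-rank and the last trivial critical ideal

initial : ∀ n → ℕ → Subset n
initial zero    k       = []
initial (suc n) zero    = outside ∷ initial n zero
initial (suc n) (suc k) = inside ∷ initial n k

∈-initial⇒< : ∀ {n} k {i : Fin n} → i Subset.∈ initial n k → toℕ i ℕ.< k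
∈-initial⇒< zero    (there i∈S) with () ← ∈-initial⇒< zero i∈S
∈-initial⇒< (suc k) here        = s≤s z≤n
∈-initial⇒< (suc k) (there i∈S) = s≤s (∈-initial⇒< k i∈S)

<⇒∈-initial : ∀ {n} k (i : Fin n) → toℕ i ℕ.< k → i Subset.∈ initial n k
<⇒∈-initial (suc k) zero    _         = here
<⇒∈-initial (suc k) (suc i) (s≤s i<k) = there (<⇒∈-initial k i i<k)

∣initial∣≤ : ∀ n k → ∣ initial n k ∣ ℕ.≤ k
∣initial∣≤ zero    k       = z≤n
∣initial∣≤ (suc n) zero    = ∣initial∣≤ n zero
∣initial∣≤ (suc n) (suc k) = s≤s (∣initial∣≤ n k)

-- Since the chain of critical ideals descends, one place where it stops being trivial determines
-- all the trivial ones. The index `i` stands for the ideal of the minors of size i + 1, so exactly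
-- the indices below `k` are counted.
threshold⇒corank : ∀ (G : Graph (Fin n)) {k l} → IsUnit G k → ¬ IsUnit G (suc k) → k ℕ.≤ l →
  AlgebraicCorank≤ G l
threshold⇒corank {n} G {k} unit ¬unit k≤l =
  _ , (initial n k , (λ i → mk⇔ (to i) (from i)) , refl) , ℕ.≤-trans (∣initial∣≤ n k) k≤l
  where
  to : ∀ i → i Subset.∈ initial n k → criticalIdeal G (suc (toℕ i)) ≐ unitIdeal
  to i i∈S = Equivalence.to (IsUnit⇔≐ G _)
    (IsUnit-antitone G (ℕ.≤⇒≤′ (∈-initial⇒< k i∈S)) unit)

  from : ∀ i → criticalIdeal G (suc (toℕ i)) ≐ unitIdeal → i Subset.∈ initial n k
  from i I≐unit = <⇒∈-initial k i (ℕ.≰⇒> λ k≤i →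
    ¬unit (IsUnit-antitone G (ℕ.≤⇒≤′ (s≤s k≤i)) (Equivalence.from (IsUnit⇔≐ G _) I≐unit)))

three-members : ∀ {m} (S : Subset (3 ℕ.+ m)) →
  0F Subset.∈ S → 1F Subset.∈ S → 2F Subset.∈ S → 3 ℕ.≤ ∣ S ∣
three-members (_ ∷ _ ∷ _ ∷ S) here (there here) (there (there here)) = s≤s (s≤s (s≤s z≤n))

increasing⇒injective : ∀ {m n} {r : Fin m → Fin n} → Monotonic₁ Fin._<_ Fin._<_ r → Injective _≡_ _≡_ r
increasing⇒injective r-mono {i} {j} ri≡rj with Fin.<-cmp i j
... | tri< i<j _ _ = contradiction ri≡rj (Fin.<⇒≢ (r-mono i<j))
... | tri≈ _ i≡j _ = i≡j
... | tri> _ _ j<i = contradiction (sym ri≡rj) (Fin.<⇒≢ (r-mono j<i))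

-- No increasing selection of `k` rows exists, so evenness of the minors is vacuous and any
-- evaluation, here at 0, will do.
size<⇒¬IsUnit : ∀ (G : Graph (Fin n)) {k} → n ℕ.< k → ¬ IsUnit G k
size<⇒¬IsUnit G {k} n<k = ¬IsUnit G k (λ _ → 0ℤ) _ (λ _ _ → refl) λ r s r-mono →
  contradiction (Fin.injective⇒≤ (increasing⇒injective r-mono)) (ℕ.<⇒≱ n<k)

-- The counted set records I₁ to Iₙ only, so graphs with fewer than three vertices are treated
-- apart. For the others, a trivial I₃ would put three indices into the set.
corank≤2⇒¬IsUnit₃ : ∀ (G : Graph (Fin n)) → AlgebraicCorank≤ G 2 → ¬ IsUnit G 3
corank≤2⇒¬IsUnit₃ {0} G _ = size<⇒¬IsUnit G (s≤s z≤n)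
corank≤2⇒¬IsUnit₃ {1} G _ = size<⇒¬IsUnit G (s≤s (s≤s z≤n))
corank≤2⇒¬IsUnit₃ {2} G _ = size<⇒¬IsUnit G (s≤s (s≤s (s≤s z≤n)))
corank≤2⇒¬IsUnit₃ {suc (suc (suc m))} G (_ , (S , S-spec , refl) , ∣S∣≤2) unit₃ =
  ℕ.<⇒≱ (three-members S (member 0F (s≤s z≤n)) (member 1F (s≤s (s≤s z≤n))) (member 2F ℕ.≤-refl)) ∣S∣≤2
  where
  member : ∀ i → suc (toℕ i) ℕ.≤ 3 → i Subset.∈ S
  member i i<3 = Equivalence.from (S-spec i) (Equivalence.to (IsUnit⇔≐ G _)
    (IsUnit-antitone G (ℕ.≤⇒≤′ i<3) unit₃))

-- A bound on the co-rank includes its exact value, so it must also be settled whether I₁ and I₂ are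
-- trivial; the three cases give the thresholds 2, 1 and 0.
¬IsUnit₃⇒corank≤2 : ∀ (G : Graph (Fin n)) → Connected G → ¬ IsUnit G 3 → AlgebraicCorank≤ G 2
¬IsUnit₃⇒corank≤2 G connected ¬unit₃ =
  by-cases (Fin.any? λ u → Fin.any? λ v → N? u v) (Fin.any? λ u → Fin.any? λ v → A? u v)
  where
  open Minors G
  open Structure G connected ¬unit₃

  by-cases : Dec (∃[ u ] ∃[ v ] N u v) → Dec (∃[ u ] ∃[ v ] A u v) → AlgebraicCorank≤ G 2
  -- Connectedness and the absence of induced P₄ provide the middle vertex of an induced path from
  -- `u` to `v`.
  by-cases (yes (u , v , uv)) _ with w , uw , wv ← common-neighbour uv =
    threshold⇒corank G (path⇒IsUnit₂ uw wv uv) ¬unit₃ ℕ.≤-refl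
  by-cases (no ¬N) (yes (u , v , uv)) = threshold⇒corank G (adjacent⇒IsUnit₁ uv)
    (¬IsUnit₂-complete G λ x y x≢y → A-by-refuting-N x≢y λ xy → ¬N (x , y , xy)) (s≤s z≤n)
  -- There is at most one vertex, and the threshold is the uncounted ideal I₀.
  by-cases (no ¬N) (no ¬A) = threshold⇒corank G (IsUnit-0 G)
    (¬IsUnit₁-edgeless G λ x y x≢y → proj₂ (N-by-refuting-A x≢y λ xy → ¬A (x , y , xy))) z≤n

theorem4p2 : ∀ (N : ℕ) (G : Graph (Fin N)) → Connected G →
    AlgebraicCorank≤ G 2 ⇔
    ((∃[ m ] ∃[ n ] ∃[ o ] (G IsInducedSubgraphOf completeTripartite m n o)) ⊎
    (∃[ m ] ∃[ n ] ∃[ o ] (G IsInducedSubgraphOf (edgeless n ∨ (complete m ∔ complete o)))))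
theorem4p2 N G connected = mk⇔ to from
  where
  to : AlgebraicCorank≤ G 2 → _
  to corank≤2 with Structure.structure G connected (corank≤2⇒¬IsUnit₃ G corank≤2)
  ... | inj₁ blowup = inj₁ (N , N , N , blowup⇒induced G (completeTripartite N N N) multipartite
    (completeTripartite-blowup N N N) blowup)
  ... | inj₂ blowup = inj₂ (N , N , N , blowup⇒induced G (edgeless N ∨ (complete N ∔ complete N)) twoCliques
    (joinOfCliques-blowup N N N) blowup)

  from : _ → AlgebraicCorank≤ G 2
  from (inj₁ (m , n , o , G⊆K)) with c , blowup ←
    pullback-blowup G (completeTripartite m n o) multipartite colour
      (completeTripartite-blowup m n o) G⊆K =
    ¬IsUnit₃⇒corank≤2 G connected (¬IsUnit₃-multipartite G c blowup)
  from (inj₂ (m , n , o , G⊆J)) with c , blowup ←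
    pullback-blowup G (edgeless n ∨ (complete m ∔ complete o)) twoCliques colour
      (joinOfCliques-blowup m n o) G⊆J =
    ¬IsUnit₃⇒corank≤2 G connected (¬IsUnit₃-twoCliques G c blowup)
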